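{- Let $g:\mathbb{R}^{10}\times\mathbb{R}^{10}\to\mathbb{R}^{16}$ be the normed bilinear map of a $[10,10,16]_{\mathbb{Z}}$ formula. Then $g$ is not a restriction of any normed bilinear map of size $[h,m,m]$; that is, for all positive integers $h,m$ and every normed bilinear map $F:\mathbb{R}^h\times\mathbb{R}^m\to\mathbb{R}^m$, $g$ is not a restriction of $F$.
   Context: All norms are Euclidean. For positive integers $r,s,n$, a normed bilinear map of size $[r,s,n]$ (equivalently, an $[r,s,n]_{\mathbb{R}}$ formula) is an $\mathbb{R}$-bilinear map $f:\mathbb{R}^r\times\mathbb{R}^s\to\mathbb{R}^n$ with $|f(x,y)|=|x|\,|y|$ for all $x\in\mathbb{R}^r$, $y\in\mathbb{R}^s$. Writing $f=(z_1,\dots,z_n)$ with each $z_k(x,y)$ a bilinear form in the coordinates $x_1,\dots,x_r$ and $y_1,\dots,y_s$, this means $(x_1^2+\cdots+x_r^2)(y_1^2+\cdots+y_s^2)=z_1^2+\cdots+z_n^2$. An $[r,s,n]_{\mathbb{Z}}$ formula is such a formula in which every bilinear form $z_k$ has integer coefficients (with respect to the standard coordinates). Restriction: Let $F:\mathbb{R}^h\times\mathbb{R}^m\to\mathbb{R}^m$ be a normed bilinear map. A normed bilinear map $g:\mathbb{R}^r\times\mathbb{R}^s\to\mathbb{R}^n$ is a restriction of $F$ if there are linear subspaces $X\subseteq\mathbb{R}^h$, $Y\subseteq\mathbb{R}^m$, $Z\subseteq\mathbb{R}^m$ of dimensions $r,s,n$ respectively with $F(X\times Y)\subseteq Z$,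 and linear isometries (onto) $\alpha:\mathbb{R}^r\to X$, $\beta:\mathbb{R}^s\to Y$, $\gamma:\mathbb{R}^n\to Z$ such that $\gamma(g(x,y))=F(\alpha(x),\beta(y))$ for all $x\in\mathbb{R}^r$, $y\in\mathbb{R}^s$. -}

module Defs where

open import Algebra.Bundles using (CommutativeRing)
open import Algebra.Definitions.RawMonoid using (sum)
open import Algebra.Module.Bundles using (LeftModule)
open import Algebra.Module.Morphism.Structures using (module LeftModuleMorphisms)
open import Data.Fin.Base using (Fin)
open import Data.Integer.Base using (ℤ)
open import Data.Nat.Base as ℕ using (ℕ)
import Data.Nat.Properties as ℕ
open import Data.Product.Base using (Σ-syntax; ∃-syntax; _×_; _,_)
open import Data.Rational.Base as ℚ using (ℚ; 0ℚ; 1ℚ; ½; ∣_∣)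
import Data.Rational.Properties as ℚ
open import Data.Rational.Solver using (module +-*-Solver)
open import Data.Vec.Functional using (Vector)
open import Level using (0ℓ)
open import Relation.Binary.PropositionalEquality
  using (_≡_; refl; sym; trans; cong; cong₂; subst)
open import Relation.Unary using (Pred; _∈_)

------------------------------------------------------------------------
-- The real numbers, as Cauchy sequences of rationals up to null sequences

IsCauchy : (ℕ → ℚ) → Set
IsCauchy u = ∀ ε → 0ℚ ℚ.< ε →
  ∃[ N ] ∀ m n → N ℕ.≤ m → N ℕ.≤ n → ∣ u m ℚ.- u n ∣ ℚ.< ε

record ℝ : Set where
  no-eta-equality
  constructor mkℝ
  field
    seq    : ℕ → ℚ
    cauchy : IsCauchy seq

open ℝ public

infix 4 _≈_

-- A record, so that x and y can be inferred from a proof of x ≈ y.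
record _≈_ (x y : ℝ) : Set where
  constructor mk≈
  field
    close : ∀ ε → 0ℚ ℚ.< ε →
      ∃[ N ] ∀ n → N ℕ.≤ n → ∣ seq x n ℚ.- seq y n ∣ ℚ.< ε

open _≈_ public

half : ∀ {ε} → 0ℚ ℚ.< ε → 0ℚ ℚ.< ε ℚ.* ½
half {ε} 0<ε = ℚ.positive⁻¹ (ε ℚ.* ½) {{ℚ.pos*pos⇒pos ε {{ℚ.positive 0<ε}} ½}}

half+half : ∀ ε → ε ℚ.* ½ ℚ.+ ε ℚ.* ½ ≡ ε
half+half ε = trans (sym (ℚ.*-distribˡ-+ ε ½ ½)) (ℚ.*-identityʳ ε)

+-close : ∀ {ε} a b c d → ∣ a ℚ.- c ∣ ℚ.< ε ℚ.* ½ → ∣ b ℚ.- d ∣ ℚ.< ε ℚ.* ½ →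
          ∣ (a ℚ.+ b) ℚ.- (c ℚ.+ d) ∣ ℚ.< ε
+-close {ε} a b c d p q = begin-strict
  ∣ (a ℚ.+ b) ℚ.- (c ℚ.+ d) ∣      ≡⟨ cong ∣_∣ lemma ⟩
  ∣ (a ℚ.- c) ℚ.+ (b ℚ.- d) ∣      ≤⟨ ℚ.∣p+q∣≤∣p∣+∣q∣ (a ℚ.- c) (b ℚ.- d) ⟩
  ∣ a ℚ.- c ∣ ℚ.+ ∣ b ℚ.- d ∣      <⟨ ℚ.+-mono-< p q ⟩
  ε ℚ.* ½ ℚ.+ ε ℚ.* ½              ≡⟨ half+half ε ⟩
  ε                                ∎
  where
  open ℚ.≤-Reasoning
  open +-*-Solver
  lemma : (a ℚ.+ b) ℚ.- (c ℚ.+ d) ≡ (a ℚ.- c) ℚ.+ (b ℚ.- d)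
  lemma = solve 4 (λ a b c d →
    (a :+ b) :- (c :+ d) := (a :- c) :+ (b :- d)) refl a b c d

swap-close : ∀ {ε} a b → ∣ a ℚ.- b ∣ ℚ.< ε → ∣ b ℚ.- a ∣ ℚ.< ε
swap-close a b = subst (ℚ._< _) (trans (sym (ℚ.∣-p∣≡∣p∣ (a ℚ.- b))) (cong ∣_∣ lemma))
  where
  open +-*-Solver
  lemma : ℚ.- (a ℚ.- b) ≡ b ℚ.- a
  lemma = solve 2 (λ a b → :- (a :- b) := b :- a) refl a b

neg-close : ∀ {ε} a b → ∣ a ℚ.- b ∣ ℚ.< ε → ∣ (ℚ.- a) ℚ.- (ℚ.- b) ∣ ℚ.< ε
neg-close a b p = subst (λ t → ∣ t ∣ ℚ.< _) lemma (swap-close a b p)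
  where
  open +-*-Solver
  lemma : b ℚ.- a ≡ (ℚ.- a) ℚ.- (ℚ.- b)
  lemma = solve 2 (λ a b → b :- a := (:- a) :- (:- b)) refl a b

trans-close : ∀ {ε} a b c → ∣ a ℚ.- b ∣ ℚ.< ε ℚ.* ½ → ∣ b ℚ.- c ∣ ℚ.< ε ℚ.* ½ →
              ∣ a ℚ.- c ∣ ℚ.< ε
trans-close a b c p q = subst (λ t → ∣ t ∣ ℚ.< _) lemma (+-close a b b c p q)
  where
  open +-*-Solver
  lemma : (a ℚ.+ b) ℚ.- (b ℚ.+ c) ≡ a ℚ.- c
  lemma = solve 3 (λ a b c → (a :+ b) :- (b :+ c) := a :- c) refl a b c

refl-close : ∀ {ε a b} → 0ℚ ℚ.< ε → a ≡ b → ∣ a ℚ.- b ∣ ℚ.< ε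
refl-close {ε} {a} 0<ε refl =
  subst (λ t → ∣ t ∣ ℚ.< ε) (sym (ℚ.+-inverseʳ a)) 0<ε

*-close : ∀ {δ ε} a b c d B C → (B ℚ.+ C) ℚ.* δ ≡ ε → ∣ a ∣ ℚ.< B → ∣ d ∣ ℚ.< C →
          ∣ a ℚ.- c ∣ ℚ.< δ → ∣ b ℚ.- d ∣ ℚ.< δ →
          ∣ a ℚ.* b ℚ.- c ℚ.* d ∣ ℚ.< ε
*-close {δ} {ε} a b c d B C eq a<B d<C p q = begin-strict
  ∣ a ℚ.* b ℚ.- c ℚ.* d ∣
    ≡⟨ cong ∣_∣ lemma₁ ⟩
  ∣ a ℚ.* (b ℚ.- d) ℚ.+ (a ℚ.- c) ℚ.* d ∣
    ≤⟨ ℚ.∣p+q∣≤∣p∣+∣q∣ (a ℚ.* (b ℚ.- d)) ((a ℚ.- c) ℚ.* d) ⟩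
  ∣ a ℚ.* (b ℚ.- d) ∣ ℚ.+ ∣ (a ℚ.- c) ℚ.* d ∣
    ≡⟨ cong₂ ℚ._+_ (ℚ.∣p*q∣≡∣p∣*∣q∣ a (b ℚ.- d)) (ℚ.∣p*q∣≡∣p∣*∣q∣ (a ℚ.- c) d) ⟩
  ∣ a ∣ ℚ.* ∣ b ℚ.- d ∣ ℚ.+ ∣ a ℚ.- c ∣ ℚ.* ∣ d ∣
    ≤⟨ ℚ.+-mono-≤
         (ℚ.*-monoʳ-≤-nonNeg ∣ b ℚ.- d ∣ {{ℚ.∣-∣-nonNeg (b ℚ.- d)}} (ℚ.<⇒≤ a<B))
         (ℚ.*-monoˡ-≤-nonNeg ∣ a ℚ.- c ∣ {{ℚ.∣-∣-nonNeg (a ℚ.- c)}} (ℚ.<⇒≤ d<C)) ⟩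
  B ℚ.* ∣ b ℚ.- d ∣ ℚ.+ ∣ a ℚ.- c ∣ ℚ.* C
    <⟨ ℚ.+-mono-<
         (ℚ.*-monoʳ-<-pos B {{bound-pos a a<B}} q)
         (ℚ.*-monoˡ-<-pos C {{bound-pos d d<C}} p) ⟩
  B ℚ.* δ ℚ.+ δ ℚ.* C
    ≡⟨ trans lemma₂ eq ⟩
  ε ∎
  where
  open ℚ.≤-Reasoning
  open +-*-Solver
  lemma₁ : a ℚ.* b ℚ.- c ℚ.* d ≡ a ℚ.* (b ℚ.- d) ℚ.+ (a ℚ.- c) ℚ.* d
  lemma₁ = solve 4 (λ a b c d →
    a :* b :- c :* d := a :* (b :- d) :+ (a :- c) :* d) refl a b c d
  lemma₂ : B ℚ.* δ ℚ.+ δ ℚ.* C ≡ (B ℚ.+ C) ℚ.* δ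
  lemma₂ = solve 3 (λ B C δ → B :* δ :+ δ :* C := (B :+ C) :* δ) refl B C δ
  bound-pos : ∀ {B} a → ∣ a ∣ ℚ.< B → ℚ.Positive B
  bound-pos a p = ℚ.positive (ℚ.≤-<-trans (ℚ.0≤∣p∣ a) p)

bounded : ∀ {u} → IsCauchy u →
          ∃[ B ] 0ℚ ℚ.< B × (∃[ N ] ∀ n → N ℕ.≤ n → ∣ u n ∣ ℚ.< B)
bounded {u} cau with N , p ← cau 1ℚ (ℚ.positive⁻¹ 1ℚ) =
  1ℚ ℚ.+ ∣ u N ∣ , 0<B , N , λ n N≤n → begin-strict
    ∣ u n ∣                        ≡⟨ cong ∣_∣ (lemma n) ⟩
    ∣ (u n ℚ.- u N) ℚ.+ u N ∣      ≤⟨ ℚ.∣p+q∣≤∣p∣+∣q∣ (u n ℚ.- u N) (u N) ⟩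
    ∣ u n ℚ.- u N ∣ ℚ.+ ∣ u N ∣    <⟨ ℚ.+-monoˡ-< ∣ u N ∣ (p n N N≤n ℕ.≤-refl) ⟩
    1ℚ ℚ.+ ∣ u N ∣                 ∎
  where
  open ℚ.≤-Reasoning
  open +-*-Solver
  0<B : 0ℚ ℚ.< 1ℚ ℚ.+ ∣ u N ∣
  0<B = ℚ.+-mono-<-≤ (ℚ.positive⁻¹ 1ℚ) (ℚ.0≤∣p∣ (u N))
  lemma : ∀ n → u n ≡ (u n ℚ.- u N) ℚ.+ u N
  lemma n = solve 2 (λ a b → a := (a :- b) :+ b) refl (u n) (u N)

divide : ∀ {B ε} → 0ℚ ℚ.< B → 0ℚ ℚ.< ε → ∃[ δ ] 0ℚ ℚ.< δ × B ℚ.* δ ≡ ε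
divide {B} {ε} 0<B 0<ε = B⁻¹ ℚ.* ε , ℚ.positive⁻¹ (B⁻¹ ℚ.* ε) {{pos}} , eq
  where
  instance
    B-pos : ℚ.Positive B
    B-pos = ℚ.positive 0<B
    B-nonZero : ℚ.NonZero B
    B-nonZero = ℚ.pos⇒nonZero B
  B⁻¹ : ℚ
  B⁻¹ = ℚ.1/ B
  pos : ℚ.Positive (B⁻¹ ℚ.* ε)
  pos = ℚ.pos*pos⇒pos B⁻¹ {{ℚ.1/pos⇒pos B}} ε {{ℚ.positive 0<ε}}
  eq : B ℚ.* (B⁻¹ ℚ.* ε) ≡ ε
  eq = trans (sym (ℚ.*-assoc B B⁻¹ ε))
      (trans (cong (ℚ._* ε) (ℚ.*-inverseʳ B)) (ℚ.*-identityˡ ε))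

⊔-≤ˡ : ∀ a b {n} → a ℕ.⊔ b ℕ.≤ n → a ℕ.≤ n
⊔-≤ˡ a b = ℕ.m⊔n≤o⇒m≤o a b

⊔-≤ʳ : ∀ a b {n} → a ℕ.⊔ b ℕ.≤ n → b ℕ.≤ n
⊔-≤ʳ a b = ℕ.m⊔n≤o⇒n≤o a b

abstract
  const-cauchy : ∀ q → IsCauchy (λ _ → q)
  const-cauchy q ε 0<ε = 0 , λ _ _ _ _ → refl-close {a = q} 0<ε refl

  +-cauchy : ∀ u v → IsCauchy u → IsCauchy v → IsCauchy (λ n → u n ℚ.+ v n)
  +-cauchy u v cu cv ε 0<ε
    with M , p ← cu (ε ℚ.* ½) (half 0<ε) | N , q ← cv (ε ℚ.* ½) (half 0<ε) =
    M ℕ.⊔ N , λ m n ≤m ≤n →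
      +-close (u m) (v m) (u n) (v n)
        (p m n (⊔-≤ˡ M N ≤m) (⊔-≤ˡ M N ≤n)) (q m n (⊔-≤ʳ M N ≤m) (⊔-≤ʳ M N ≤n))

  neg-cauchy : ∀ u → IsCauchy u → IsCauchy (λ n → ℚ.- u n)
  neg-cauchy u cu ε 0<ε with N , p ← cu ε 0<ε =
    N , λ m n ≤m ≤n → neg-close (u m) (u n) (p m n ≤m ≤n)

  *-cauchy : ∀ u v → IsCauchy u → IsCauchy v → IsCauchy (λ n → u n ℚ.* v n)
  *-cauchy u v cu cv ε 0<ε =
    let B , 0<B , K , b = bounded cu
        C , 0<C , L , c = bounded cv
        δ , 0<δ , eq    = divide (ℚ.+-mono-< 0<B 0<C) 0<ε
        M , p           = cu δ 0<δ
        N , q           = cv δ 0<δ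
    in (K ℕ.⊔ L) ℕ.⊔ (M ℕ.⊔ N) , λ m n ≤m ≤n →
      let ≤m₁ = ⊔-≤ˡ (K ℕ.⊔ L) (M ℕ.⊔ N) ≤m ; ≤m₂ = ⊔-≤ʳ (K ℕ.⊔ L) (M ℕ.⊔ N) ≤m
          ≤n₁ = ⊔-≤ˡ (K ℕ.⊔ L) (M ℕ.⊔ N) ≤n ; ≤n₂ = ⊔-≤ʳ (K ℕ.⊔ L) (M ℕ.⊔ N) ≤n
      in *-close (u m) (v m) (u n) (v n) B C eq
           (b m (⊔-≤ˡ K L ≤m₁)) (c n (⊔-≤ʳ K L ≤n₁))
           (p m n (⊔-≤ˡ M N ≤m₂) (⊔-≤ˡ M N ≤n₂))
           (q m n (⊔-≤ʳ M N ≤m₂) (⊔-≤ʳ M N ≤n₂))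

infixl 6 _+_
infixl 7 _*_
infix  8 -_

fromℚ : ℚ → ℝ
fromℚ q = mkℝ (λ _ → q) (const-cauchy q)

fromℤ : ℤ → ℝ
fromℤ k = fromℚ (k ℚ./ 1)

0ℝ 1ℝ : ℝ
0ℝ = fromℚ 0ℚ
1ℝ = fromℚ 1ℚ

_+_ _*_ : ℝ → ℝ → ℝ
x + y = mkℝ (λ n → seq x n ℚ.+ seq y n) (+-cauchy (seq x) (seq y) (cauchy x) (cauchy y))
x * y = mkℝ (λ n → seq x n ℚ.* seq y n) (*-cauchy (seq x) (seq y) (cauchy x) (cauchy y))

-_ : ℝ → ℝ
- x = mkℝ (λ n → ℚ.- seq x n) (neg-cauchy (seq x) (cauchy x))

pointwise⇒≈ : ∀ {x y} → (∀ n → seq x n ≡ seq y n) → x ≈ y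
pointwise⇒≈ eq = mk≈ λ ε 0<ε → 0 , λ n _ → refl-close 0<ε (eq n)

≈-refl : ∀ {x} → x ≈ x
≈-refl = pointwise⇒≈ λ _ → refl

≈-sym : ∀ {x y} → x ≈ y → y ≈ x
≈-sym {x} {y} x≈y = mk≈ λ ε 0<ε →
  let N , p = close x≈y ε 0<ε
  in N , λ n N≤n → swap-close (seq x n) (seq y n) (p n N≤n)

≈-trans : ∀ {x y z} → x ≈ y → y ≈ z → x ≈ z
≈-trans {x} {y} {z} x≈y y≈z = mk≈ λ ε 0<ε →
  let M , p = close x≈y (ε ℚ.* ½) (half 0<ε)
      N , q = close y≈z (ε ℚ.* ½) (half 0<ε)
  in M ℕ.⊔ N , λ n ≤n → trans-close (seq x n) (seq y n) (seq z n)
       (p n (⊔-≤ˡ M N ≤n)) (q n (⊔-≤ʳ M N ≤n))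

+-cong : ∀ {x x′ y y′} → x ≈ x′ → y ≈ y′ → x + y ≈ x′ + y′
+-cong {x} {x′} {y} {y′} x≈x′ y≈y′ = mk≈ λ ε 0<ε →
  let M , p = close x≈x′ (ε ℚ.* ½) (half 0<ε)
      N , q = close y≈y′ (ε ℚ.* ½) (half 0<ε)
  in M ℕ.⊔ N , λ n ≤n → +-close (seq x n) (seq y n) (seq x′ n) (seq y′ n)
       (p n (⊔-≤ˡ M N ≤n)) (q n (⊔-≤ʳ M N ≤n))

-‿cong : ∀ {x y} → x ≈ y → - x ≈ - y
-‿cong {x} {y} x≈y = mk≈ λ ε 0<ε →
  let N , p = close x≈y ε 0<ε
  in N , λ n N≤n → neg-close (seq x n) (seq y n) (p n N≤n)

*-cong : ∀ {x x′ y y′} → x ≈ x′ → y ≈ y′ → x * y ≈ x′ * y′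
*-cong {x} {x′} {y} {y′} x≈x′ y≈y′ = mk≈ λ ε 0<ε →
  let B , 0<B , K , b = bounded (cauchy x)
      C , 0<C , L , c = bounded (cauchy y′)
      δ , 0<δ , eq    = divide (ℚ.+-mono-< 0<B 0<C) 0<ε
      M , p           = close x≈x′ δ 0<δ
      N , q           = close y≈y′ δ 0<δ
  in (K ℕ.⊔ L) ℕ.⊔ (M ℕ.⊔ N) , λ n ≤n →
    let ≤n₁ = ⊔-≤ˡ (K ℕ.⊔ L) (M ℕ.⊔ N) ≤n ; ≤n₂ = ⊔-≤ʳ (K ℕ.⊔ L) (M ℕ.⊔ N) ≤n
    in *-close (seq x n) (seq y n) (seq x′ n) (seq y′ n) B C eq
         (b n (⊔-≤ˡ K L ≤n₁)) (c n (⊔-≤ʳ K L ≤n₁))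
         (p n (⊔-≤ˡ M N ≤n₂)) (q n (⊔-≤ʳ M N ≤n₂))

ℝ-commutativeRing : CommutativeRing 0ℓ 0ℓ
ℝ-commutativeRing = record
  { Carrier = ℝ ; _≈_ = _≈_ ; _+_ = _+_ ; _*_ = _*_ ; -_ = -_ ; 0# = 0ℝ ; 1# = 1ℝ
  ; isCommutativeRing = record
    { isRing = record
      { +-isAbelianGroup = record
        { isGroup = record
          { isMonoid = record
            { isSemigroup = record
              { isMagma = record
                { isEquivalence = record
                  { refl  = ≈-refl
                  ; sym   = ≈-sym
                  ; trans = ≈-trans
                  }
                ; ∙-cong = +-cong
                }
              ; assoc = λ x y z → pointwise⇒≈ λ n → ℚ.+-assoc (seq x n) (seq y n) (seq z n)
              }
            ; identity = (λ x → pointwise⇒≈ λ n → ℚ.+-identityˡ (seq x n))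
                       , (λ x → pointwise⇒≈ λ n → ℚ.+-identityʳ (seq x n))
            }
          ; inverse = (λ x → pointwise⇒≈ λ n → ℚ.+-inverseˡ (seq x n))
                    , (λ x → pointwise⇒≈ λ n → ℚ.+-inverseʳ (seq x n))
          ; ⁻¹-cong = -‿cong
          }
        ; comm = λ x y → pointwise⇒≈ λ n → ℚ.+-comm (seq x n) (seq y n)
        }
      ; *-cong = *-cong
      ; *-assoc = λ x y z → pointwise⇒≈ λ n → ℚ.*-assoc (seq x n) (seq y n) (seq z n)
      ; *-identity = (λ x → pointwise⇒≈ λ n → ℚ.*-identityˡ (seq x n))
                   , (λ x → pointwise⇒≈ λ n → ℚ.*-identityʳ (seq x n))
      ; distrib = (λ x y z → pointwise⇒≈ λ n → ℚ.*-distribˡ-+ (seq x n) (seq y n) (seq z n))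
                , (λ x y z → pointwise⇒≈ λ n → ℚ.*-distribʳ-+ (seq x n) (seq y n) (seq z n))
      }
    ; *-comm = λ x y → pointwise⇒≈ λ n → ℚ.*-comm (seq x n) (seq y n)
    }
  }

------------------------------------------------------------------------
-- The vector space ℝⁿ and its subspaces

module R = CommutativeRing ℝ-commutativeRing

ℝ^_ : ℕ → LeftModule R.ring 0ℓ 0ℓ
ℝ^ n = record
  { Carrierᴹ = Vector ℝ n
  ; _≈ᴹ_     = λ u v → ∀ i → u i ≈ v i
  ; _+ᴹ_     = λ u v i → u i + v i
  ; _*ₗ_     = λ a v i → a * v i
  ; 0ᴹ       = λ _ → 0ℝ
  ; -ᴹ_      = λ v i → - v i
  ; isLeftModule = record
    { isLeftSemimodule = record
      { +ᴹ-isCommutativeMonoid = record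
        { isMonoid = record
          { isSemigroup = record
            { isMagma = record
              { isEquivalence = record
                { refl  = λ _ → R.refl
                ; sym   = λ p i → R.sym (p i)
                ; trans = λ p q i → R.trans (p i) (q i)
                }
              ; ∙-cong = λ p q i → R.+-cong (p i) (q i)
              }
            ; assoc = λ u v w i → R.+-assoc (u i) (v i) (w i)
            }
          ; identity = (λ v i → R.+-identityˡ (v i)) , (λ v i → R.+-identityʳ (v i))
          }
        ; comm = λ u v i → R.+-comm (u i) (v i)
        }
      ; isPreleftSemimodule = record
        { *ₗ-cong      = λ p q i → R.*-cong p (q i)
        ; *ₗ-zeroˡ     = λ v i → R.zeroˡ (v i)
        ; *ₗ-distribʳ  = λ v a b i → R.distribʳ (v i) a b
        ; *ₗ-identityˡ = λ v i → R.*-identityˡ (v i)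
        ; *ₗ-assoc     = λ a b v i → R.*-assoc a b (v i)
        ; *ₗ-zeroʳ     = λ a i → R.zeroʳ a
        ; *ₗ-distribˡ  = λ a u v i → R.distribˡ a (u i) (v i)
        }
      }
    ; -ᴹ‿cong    = λ p i → R.-‿cong (p i)
    ; -ᴹ‿inverse = (λ v i → R.-‿inverseˡ (v i)) , (λ v i → R.-‿inverseʳ (v i))
    }
  }

module _ {n : ℕ} where
  open LeftModule (ℝ^ n) public
    using (_≈ᴹ_; _+ᴹ_; _*ₗ_; 0ᴹ)

∑ : ∀ {n} → Vector ℝ n → ℝ
∑ = sum R.+-rawMonoid

linearCombination : ∀ {d n} → Vector ℝ d → Vector (Vector ℝ n) d → Vector ℝ n
linearCombination {n = n} a v = sum (LeftModule.+ᴹ-rawMonoid (ℝ^ n)) (λ i → a i *ₗ v i)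

IsLinear : ∀ {m n} → (Vector ℝ m → Vector ℝ n) → Set
IsLinear {m} {n} = IsLeftModuleHomomorphism
  where open LeftModuleMorphisms (LeftModule.rawLeftModule (ℝ^ m)) (LeftModule.rawLeftModule (ℝ^ n))

record IsSubspace {n} (X : Pred (Vector ℝ n) 0ℓ) : Set where
  field
    resp-≈ : ∀ {u v} → u ≈ᴹ v → u ∈ X → v ∈ X
    0-mem  : 0ᴹ ∈ X
    +-mem  : ∀ {u v} → u ∈ X → v ∈ X → u +ᴹ v ∈ X
    *-mem  : ∀ a {v} → v ∈ X → a *ₗ v ∈ X

record IsBasis {n d} (X : Pred (Vector ℝ n) 0ℓ) (b : Vector (Vector ℝ n) d) : Set where
  field
    mem         : ∀ i → b i ∈ X
    independent : ∀ a → linearCombination a b ≈ᴹ 0ᴹ → a ≈ᴹ 0ᴹ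
    spanning    : ∀ {v} → v ∈ X → ∃[ a ] v ≈ᴹ linearCombination a b

record IsSubspaceOfDim {n} (d : ℕ) (X : Pred (Vector ℝ n) 0ℓ) : Set where
  field
    isSubspace : IsSubspace X
    basis      : Vector (Vector ℝ n) d
    isBasis    : IsBasis X basis

------------------------------------------------------------------------
-- Normed bilinear maps

-- The square of the Euclidean norm.  Norms being nonnegative, |u| = |v| is
-- ∣ u ∣² ≈ ∣ v ∣², and |w| = |u||v| is ∣ w ∣² ≈ ∣ u ∣² * ∣ v ∣².
∣_∣² : ∀ {n} → Vector ℝ n → ℝ
∣ v ∣² = ∑ (λ i → v i * v i)

record NormedBilinearMap (r s n : ℕ) : Set where
  field
    map     : Vector ℝ r → Vector ℝ s → Vector ℝ n
    linearˡ : ∀ y → IsLinear (λ x → map x y)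
    linearʳ : ∀ x → IsLinear (map x)
    normed  : ∀ x y → ∣ map x y ∣² ≈ ∣ x ∣² * ∣ y ∣²

open NormedBilinearMap public using (map)

IsIntegral : ∀ {r s n} → NormedBilinearMap r s n → Set
IsIntegral {r} {s} {n} g = Σ[ c ∈ (Fin n → Fin r → Fin s → ℤ) ] ∀ k x y →
  map g x y k ≈ ∑ (λ i → ∑ (λ j → fromℤ (c k i j) * (x i * y j)))

record IsLinearIsometryOnto {d n} (X : Pred (Vector ℝ n) 0ℓ)
                            (φ : Vector ℝ d → Vector ℝ n) : Set where
  field
    isLinear : IsLinear φ
    isometry : ∀ v → ∣ φ v ∣² ≈ ∣ v ∣²
    into     : ∀ v → φ v ∈ X
    onto     : ∀ {w} → w ∈ X → ∃[ v ] φ v ≈ᴹ w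

record IsRestriction {r s n h m} (g : NormedBilinearMap r s n)
                     (F : NormedBilinearMap h m m) : Set₁ where
  field
    X : Pred (Vector ℝ h) 0ℓ
    Y : Pred (Vector ℝ m) 0ℓ
    Z : Pred (Vector ℝ m) 0ℓ
    X-subspace : IsSubspaceOfDim r X
    Y-subspace : IsSubspaceOfDim s Y
    Z-subspace : IsSubspaceOfDim n Z
    F⟨X×Y⟩⊆Z : ∀ {x y} → x ∈ X → y ∈ Y → map F x y ∈ Z
    α : Vector ℝ r → Vector ℝ h
    β : Vector ℝ s → Vector ℝ m
    γ : Vector ℝ n → Vector ℝ m
    α-isometry : IsLinearIsometryOnto X α
    β-isometry : IsLinearIsometryOnto Y β
    γ-isometry : IsLinearIsometryOnto Z γ
    commutes : ∀ x y → γ (map g x y) ≈ᴹ map F (α x) (β y)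

{-# OPTIONS --safe #-}
module Submission where

-- Put Aᵢ = F(α eᵢ).  These are square isometries, hence invertible, so the products Aᵢᵀ Aₖ commute
-- or anticommute with one another.  Integrality gives g(eᵢ, eⱼ) = ± e_{c i j} for an intercalate
-- matrix c, and c i j = c k l says that β eⱼ = ± Aᵢᵀ Aₖ (β eₗ).  Two pairs of rows related in this
-- way to the same two columns form a quadruple whose product fixes a vector up to sign, and
-- operators with a common eigenvector cannot anticommute: any two quadruples of rows meet in an
-- even number of rows.  But a 10 × 10 intercalate matrix in only 16 colours repeats colours so
-- often that quadruples with odd intersection exist.

open import Algebra.Bundles using (CommutativeRing)
open import Algebra.Module.Bundles using (LeftModule)
open import Algebra.Module.Morphism.Structures using (module LeftModuleMorphisms)
import Algebra.Properties.CommutativeSemigroup as CommutativeSemigroupProperties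
import Algebra.Properties.Ring as RingProperties
import Algebra.Properties.Semiring.Sum as SemiringSum
import Algebra.Solver.Ring.NaturalCoefficients.Default as SemiringSolver
open import Data.Bool.Base using (if_then_else_)
open import Data.Empty using (⊥)
open import Data.Fin.Base using (Fin; zero; suc; _<_)
open import Data.Fin.Patterns
import Data.Fin.Properties as Fin
open import Data.Integer.Base as ℤ using (ℤ; -[1+_])
import Data.Integer.Properties as ℤ
open import Data.List.Base as List using (List; []; _∷_; _++_; length; lookup)
open import Data.List.Membership.DecPropositional using (_∈?_)
open import Data.List.Membership.Propositional using (_∈_; _∉_)
open import Data.List.Membership.Propositional.Properties using (∈-lookup)
open import Data.List.Relation.Unary.All as All using ([]; _∷_)
open import Data.List.Relation.Unary.All.Properties using (¬Any⇒All¬)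
open import Data.List.Relation.Unary.AllPairs using ([]; _∷_)
open import Data.List.Relation.Unary.Any as Any using (here; there)
open import Data.List.Relation.Unary.Any.Properties using (lookup-index)
open import Data.List.Relation.Unary.Unique.Propositional using (Unique)
open import Data.Nat.Base as ℕ using (ℕ; zero; suc; z≤n; s≤s; NonZero)
import Data.Nat.Coprimality as Coprimality
import Data.Nat.Properties as ℕ
open import Data.Product.Base using (∃-syntax; _×_; _,_; proj₁; proj₂)
open import Data.Rational.Base as ℚ using (ℚ; mkℚ; 0ℚ; ½; ∣_∣)
import Data.Rational.Properties as ℚ
open import Data.Rational.Solver using (module +-*-Solver)
open import Data.Sign.Base as Sign using (Sign)
import Data.Sign.Properties as Sign
open import Data.Sum.Base using (_⊎_; inj₁; inj₂; [_,_]′)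
open import Data.Unit.Base using (tt)
open import Data.Vec.Functional using (Vector; tail) renaming (_∷_ to _∷ᵛ_)
open import Function.Base using (_∘_; id; case_of_)
open import Function.Definitions using (Injective)
open import Level using (0ℓ)
open import Relation.Binary.Definitions using (tri<; tri≈; tri>)
open import Relation.Binary.PropositionalEquality as ≡ using (_≡_; _≢_)
import Relation.Binary.Reasoning.Setoid as SetoidReasoning
open import Relation.Nullary
open import Relation.Nullary.Decidable using (toWitness; dec-true; dec-false; _×-dec_; _⊎-dec_; _→-dec_; ¬?)
open import Relation.Unary using (Pred)

-- Squareness enters through Aᵢ Aᵢᵀ = 1, which lets factors move past each other in the middle of a
-- product. Equality of Cauchy reals is undecidable, so no rank argument is used: the identity comes
-- from a vanishing sum of squares. A relation fixes, up to sign, a basis vector of its own column,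
-- so two relations start with different eigenvectors. Since 10 + 10 > 16, any two columns share a
-- colour, hence some Aᵢᵀ Aₖ links their vectors. It commutes with every quadruple product up to
-- sign, so all eigenvectors can be carried to one column. The rows matched between two columns form
-- disjoint pairs, and 30 - 16 > 3 · 4 makes some two of any three columns share more than four
-- colours, which gives three pairs. Two quadruples on a common pair, with a third through just one
-- row of that pair, leave so few possibilities for further quadruples that the contradiction is a
-- finite check.

module ℕ∑ = SemiringSum ℕ.+-*-semiring

-- Counting common values of injective maps

module Counting where
  open ℕ∑
  open ≡ using (refl; sym; trans; cong; cong₂; subst; module ≡-Reasoning)

  δ : ∀ {n} → Fin n → Fin n → ℕ
  δ i k = if does (i Fin.≟ k) then 1 else 0

  δ-≡ : ∀ {n} (i : Fin n) → δ i i ≡ 1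
  δ-≡ i rewrite dec-true (i Fin.≟ i) refl = refl

  δ-≢ : ∀ {n} {i k : Fin n} → i ≢ k → δ i k ≡ 0
  δ-≢ {i = i} {k} i≢k rewrite dec-false (i Fin.≟ k) i≢k = refl

  Σ-mono : ∀ {n} {f g : Fin n → ℕ} → (∀ i → f i ℕ.≤ g i) → sum f ℕ.≤ sum g
  Σ-mono {zero}  f≤g = z≤n
  Σ-mono {suc n} f≤g = ℕ.+-mono-≤ (f≤g zero) (Σ-mono (f≤g ∘ suc))

  Σ-0 : ∀ {n} {f : Fin n → ℕ} → (∀ i → f i ≡ 0) → sum f ≡ 0
  Σ-0 {n} f≡0 = trans (sum-cong-≗ f≡0) (sum-replicate-zero n)

  Σ-δ : ∀ {n} (i : Fin n) (h : Fin n → ℕ) → sum (λ z → δ i z ℕ.* h z) ≡ h i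
  Σ-δ {suc n} zero h = trans (cong₂ ℕ._+_ (ℕ.+-identityʳ (h zero)) (Σ-0 {n} {f = λ _ → 0} λ _ → refl)) (ℕ.+-identityʳ _)
  Σ-δ (suc i) h = Σ-δ i (h ∘ suc)

  occurrences : ∀ {r n} → (Fin r → Fin n) → Fin n → ℕ
  occurrences f z = sum λ i → δ (f i) z

  module _ {r n} (f : Fin r → Fin n) where

    occurrences-≤1 : Injective _≡_ _≡_ f → ∀ z → occurrences f z ℕ.≤ 1
    occurrences-≤1 = go f
      where
      go : ∀ {r} (f : Fin r → Fin n) → Injective _≡_ _≡_ f → ∀ z → occurrences f z ℕ.≤ 1
      go {zero}  f inj z = z≤n
      go {suc r} f inj z with f zero Fin.≟ z
      ... | no  _    = go (f ∘ suc) (Fin.suc-injective ∘ inj) z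
      ... | yes refl = ℕ.≤-reflexive (cong suc (Σ-0 {f = λ i → δ (f (suc i)) z} λ i → δ-≢ λ eq → Fin.0≢1+n (inj (sym eq))))

    Σ-occurrences : (h : Fin n → ℕ) →
                    sum (λ z → occurrences f z ℕ.* h z) ≡ sum (λ i → h (f i))
    Σ-occurrences h = begin
      sum (λ z → occurrences f z ℕ.* h z)
        ≡⟨ sum-cong-≗ (λ z → *-distribʳ-sum (h z) λ i → δ (f i) z) ⟩
      sum (λ z → sum λ i → δ (f i) z ℕ.* h z)
        ≡⟨ ∑-comm (λ z i → δ (f i) z ℕ.* h z) ⟩
      sum (λ i → sum λ z → δ (f i) z ℕ.* h z)
        ≡⟨ sum-cong-≗ (λ i → Σ-δ (f i) h) ⟩
      sum (λ i → h (f i)) ∎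
      where open ≡-Reasoning

  Σ-1 : ∀ n → sum {n} (λ _ → 1) ≡ n
  Σ-1 n = trans (sum-replicate n {1}) (go n)
    where
    open import Algebra.Definitions.RawMonoid ℕ.+-0-rawMonoid using () renaming (_×_ to _·_)
    go : ∀ n → n · 1 ≡ n
    go zero    = refl
    go (suc n) = cong suc (go n)

  occurrences-total : ∀ {r n} (f : Fin r → Fin n) → sum (occurrences f) ≡ r
  occurrences-total {r} f =
    trans (sum-cong-≗ λ z → sym (ℕ.*-identityʳ (occurrences f z)))
          (trans (Σ-occurrences f λ _ → 1) (Σ-1 r))

  opaque
    -- Counts pairs of arguments with equal values, hence common values when both maps are
    -- injective. Being opaque, it is not expanded into explicit sums at the sizes 10 and 16.
    shared : ∀ {r s n} → (Fin r → Fin n) → (Fin s → Fin n) → ℕ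
    shared f g = sum λ z → occurrences f z ℕ.* occurrences g z

  2-bits : ∀ {a b} → a ℕ.≤ 1 → b ℕ.≤ 1 → a ℕ.+ b ℕ.≤ 1 ℕ.+ a ℕ.* b
  2-bits z≤n       b≤1       = b≤1
  2-bits (s≤s z≤n) z≤n       = s≤s z≤n
  2-bits (s≤s z≤n) (s≤s z≤n) = ℕ.≤-refl

  -- The right side exceeds the left by (1 - a)(1 - b)(1 - c) + abc. Summed over all colours this is
  -- the Bonferroni inequality `shared-3`.
  3-bits : ∀ {a b c} → a ℕ.≤ 1 → b ℕ.≤ 1 → c ℕ.≤ 1 →
           a ℕ.+ (b ℕ.+ c) ℕ.≤ 1 ℕ.+ (a ℕ.* b ℕ.+ (b ℕ.* c ℕ.+ a ℕ.* c))
  3-bits {c = c} z≤n b≤1 c≤1 = ℕ.≤-trans (2-bits b≤1 c≤1) (s≤s (ℕ.m≤m+n _ 0))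
  3-bits (s≤s z≤n) z≤n       z≤n       = ℕ.≤-refl
  3-bits (s≤s z≤n) z≤n       (s≤s z≤n) = ℕ.≤-refl
  3-bits (s≤s z≤n) (s≤s z≤n) z≤n       = ℕ.≤-refl
  3-bits (s≤s z≤n) (s≤s z≤n) (s≤s z≤n) = s≤s (s≤s (s≤s z≤n))

  module _ {n : ℕ} where

    private
      Σ-+ : ∀ (f g : Fin n → ℕ) → sum (λ z → f z ℕ.+ g z) ≡ sum f ℕ.+ sum g
      Σ-+ = ∑-distrib-+

    opaque
      unfolding shared

      shared-2 : ∀ {r s} {f : Fin r → Fin n} {g : Fin s → Fin n} →
                 Injective _≡_ _≡_ f → Injective _≡_ _≡_ g → r ℕ.+ s ℕ.≤ n ℕ.+ shared f g
      shared-2 {r} {s} {f} {g} f-inj g-inj = begin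
        r ℕ.+ s
          ≡⟨ cong₂ ℕ._+_ (occurrences-total f) (occurrences-total g) ⟨
        sum (occurrences f) ℕ.+ sum (occurrences g)
          ≡⟨ Σ-+ (occurrences f) (occurrences g) ⟨
        sum (λ z → occurrences f z ℕ.+ occurrences g z)
          ≤⟨ Σ-mono (λ z → 2-bits (occurrences-≤1 f f-inj z) (occurrences-≤1 g g-inj z)) ⟩
        sum (λ z → 1 ℕ.+ occurrences f z ℕ.* occurrences g z)
          ≡⟨ Σ-+ _ _ ⟩
        sum {n} (λ _ → 1) ℕ.+ shared f g
          ≡⟨ cong (ℕ._+ shared f g) (Σ-1 n) ⟩
        n ℕ.+ shared f g ∎
        where open ℕ.≤-Reasoning

      shared-3 : ∀ {r s t} {f : Fin r → Fin n} {g : Fin s → Fin n} {h : Fin t → Fin n} →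
                 Injective _≡_ _≡_ f → Injective _≡_ _≡_ g → Injective _≡_ _≡_ h →
                 r ℕ.+ (s ℕ.+ t) ℕ.≤ n ℕ.+ (shared f g ℕ.+ (shared g h ℕ.+ shared f h))
      shared-3 {r} {s} {t} {f} {g} {h} f-inj g-inj h-inj = begin
        r ℕ.+ (s ℕ.+ t)
          ≡⟨ cong₂ ℕ._+_ (occurrences-total f) (cong₂ ℕ._+_ (occurrences-total g) (occurrences-total h)) ⟨
        sum #f ℕ.+ (sum #g ℕ.+ sum #h)
          ≡⟨ trans (Σ-+ #f _) (cong (sum #f ℕ.+_) (Σ-+ #g #h)) ⟨
        sum (λ z → #f z ℕ.+ (#g z ℕ.+ #h z))
          ≤⟨ Σ-mono (λ z → 3-bits (occurrences-≤1 f f-inj z) (occurrences-≤1 g g-inj z) (occurrences-≤1 h h-inj z)) ⟩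
        sum (λ z → 1 ℕ.+ (#f z ℕ.* #g z ℕ.+ (#g z ℕ.* #h z ℕ.+ #f z ℕ.* #h z)))
          ≡⟨ trans (Σ-+ _ _) (cong₂ ℕ._+_ (Σ-1 n) (trans (Σ-+ _ _) (cong (shared f g ℕ.+_) (Σ-+ _ _)))) ⟩
        n ℕ.+ (shared f g ℕ.+ (shared g h ℕ.+ shared f h)) ∎
        where
        open ℕ.≤-Reasoning
        #f #g #h : Fin n → ℕ
        #f = occurrences f
        #g = occurrences g
        #h = occurrences h

      -- At most length E of the shared values are attained by f inside E.
      shared-avoiding : ∀ {r s} {f : Fin r → Fin n} {g : Fin s → Fin n} → Injective _≡_ _≡_ g →
                        (E : List (Fin r)) → length E ℕ.< shared f g →
                        ∃[ i ] i ∉ E × ∃[ k ] f i ≡ g k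
      shared-avoiding {r} {s} {f} {g} g-inj E E<shared
        with Fin.any? (λ i → ¬? (_∈?_ Fin._≟_ i E) ×-dec Fin.any? (λ k → f i Fin.≟ g k))
      ... | yes found = found
      ... | no  none  = contradiction E<shared (ℕ.≤⇒≯ (begin
        shared f g                            ≡⟨ Σ-occurrences f (occurrences g) ⟩
        sum (λ i → occurrences g (f i))        ≤⟨ Σ-mono bound ⟩
        sum (multiplicity E)                   ≡⟨ total E ⟩
        length E                              ∎))
        where
        open ℕ.≤-Reasoning
        multiplicity : List (Fin r) → Fin r → ℕ
        multiplicity []       i = 0
        multiplicity (e ∷ es) i = δ e i ℕ.+ multiplicity es i
        total : ∀ es → sum (multiplicity es) ≡ length es
        total []       = Σ-0 {r} {λ _ → 0} (λ _ → refl)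
        total (e ∷ es) = trans (∑-distrib-+ (δ e) (multiplicity es)) (cong₂ ℕ._+_
          (trans (sum-cong-≗ λ i → sym (ℕ.*-identityʳ (δ e i))) (Σ-δ e λ _ → 1)) (total es))
        ∈⇒1≤ : ∀ {i es} → i ∈ es → 1 ℕ.≤ multiplicity es i
        ∈⇒1≤ {i} (here refl)       = ℕ.≤-trans (ℕ.≤-reflexive (sym (δ-≡ i))) (ℕ.m≤m+n _ _)
        ∈⇒1≤ (there i∈es) = ℕ.≤-trans (∈⇒1≤ i∈es) (ℕ.m≤n+m _ _)
        bound : ∀ i → occurrences g (f i) ℕ.≤ multiplicity E i
        bound i with _∈?_ Fin._≟_ i E
        ... | yes i∈E = ℕ.≤-trans (occurrences-≤1 g g-inj (f i)) (∈⇒1≤ i∈E)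
        ... | no  i∉E = ℕ.≤-trans (ℕ.≤-reflexive
          (Σ-0 {f = λ k → δ (g k) (f i)} λ k → δ-≢ λ eq → none (i , i∉E , k , sym eq))) z≤n

  opaque
    unfolding shared

    shared-self : ∀ n → shared {n} {n} (λ i → i) (λ i → i) ≡ n
    shared-self n = trans (Σ-occurrences {n} (λ i → i) (occurrences λ i → i)) (occurrences-total {n} λ i → i)

  -- The identity shares all `n` values with itself, so `shared-avoiding` specialises to the
  -- pigeonhole principle.
  fresh : ∀ {n} (E : List (Fin n)) → length E ℕ.< n → ∃[ i ] i ∉ E
  fresh {n} E E<n =
    let i , i∉E , _ = shared-avoiding {f = λ i → i} {g = λ i → i} (λ eq → eq) E (subst (length E ℕ.<_) (sym (shared-self n)) E<n)
    in i , i∉E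

open Counting using (shared; shared-2; shared-3; shared-avoiding; fresh)

-- Parities of intersections and the finite check

module Parity where
  open ≡ using (refl; sym; trans; cong; cong₂)

  σ : ∀ {n} → Fin n → Fin n → Sign
  σ i k = if does (i Fin.≟ k) then Sign.- else Sign.+

  against : ∀ {n} → Fin n → List (Fin n) → Sign
  against x []       = Sign.+
  against x (y ∷ ys) = σ x y Sign.* against x ys

  -- The sign (-1)^N, where N counts equal pairs; for lists without repetition N is the size of the
  -- intersection. With values in `Sign` it serves directly as the commutation factor of two
  -- operator products.
  parity : ∀ {n} → List (Fin n) → List (Fin n) → Sign
  parity []       ys = Sign.+
  parity (x ∷ xs) ys = against x ys Sign.* parity xs ys

  -- Quadruples of rows are constrained by the parity of their intersections with 4567, 4589 and a
  -- third quadruple 4xpq.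
  Compatible₂ : (x p q : Fin 10) → Set
  Compatible₂ x p q =
    parity (4F ∷ 5F ∷ 6F ∷ 7F ∷ []) (4F ∷ x ∷ p ∷ q ∷ []) ≡ Sign.+ ×
    parity (4F ∷ 5F ∷ 8F ∷ 9F ∷ []) (4F ∷ x ∷ p ∷ q ∷ []) ≡ Sign.+

  Compatible₃ : (x p q i s t : Fin 10) → Set
  Compatible₃ x p q i s t =
    Compatible₂ i s t × parity (4F ∷ x ∷ p ∷ q ∷ []) (4F ∷ i ∷ s ∷ t ∷ []) ≡ Sign.+

  Compatible₂? : ∀ x p q → Dec (Compatible₂ x p q)
  Compatible₂? x p q = (_ Sign.≟ _) ×-dec (_ Sign.≟ _)

  Compatible₃? : ∀ x p q i s t → Dec (Compatible₃ x p q i s t)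
  Compatible₃? x p q i s t = Compatible₂? i s t ×-dec (_ Sign.≟ _)

  -- Evenness against the three known quadruples forces any completions of `4, i` and `4, k` to meet
  -- oddly. Conditions are interleaved with quantifiers so that the exhaustive search prunes early,
  -- and `s < t` selects one order of the last two rows.
  Clash : (x p q i k : Fin 10) → Set
  Clash x p q i k =
    ∀ s → s ≢ 4F → ∀ t → s < t → t ≢ 4F → Compatible₃ x p q i s t →
    ∀ s′ → s′ ≢ 4F → ∀ t′ → s′ < t′ → t′ ≢ 4F → Compatible₃ x p q k s′ t′ →
    parity (4F ∷ i ∷ s ∷ t ∷ []) (4F ∷ k ∷ s′ ∷ t′ ∷ []) ≡ Sign.-

  Clash? : ∀ x p q i k → Dec (Clash x p q i k)
  Clash? x p q i k =
    Fin.all? λ s → ¬? (s Fin.≟ 4F) →-dec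
    Fin.all? λ t → (s Fin.<? t) →-dec ¬? (t Fin.≟ 4F) →-dec Compatible₃? x p q i s t →-dec
    Fin.all? λ s′ → ¬? (s′ Fin.≟ 4F) →-dec
    Fin.all? λ t′ → (s′ Fin.<? t′) →-dec ¬? (t′ Fin.≟ 4F) →-dec Compatible₃? x p q k s′ t′ →-dec
    (_ Sign.≟ _)

  Avoids45 : Fin 10 → Set
  Avoids45 x = x ≢ 4F × x ≢ 5F

  Avoids45? : ∀ x → Dec (Avoids45 x)
  Avoids45? x = ¬? (x Fin.≟ 4F) ×-dec ¬? (x Fin.≟ 5F)

  -- 4567, 4589 and 4xpq together cover seven rows and behave like the complements of the lines of a
  -- Fano plane.  For a row i outside these seven, 4st must be a line, and lines through 4 share only
  -- 4 or coincide, so 4ist and 4ks′t′ meet in one or three rows.  Exactly one of x, p, q is among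
  -- 0123, so either 0 and 1 or 2 and 3 are outside the seven rows.
  abstract
    clash : ∀ x → Avoids45 x → ∀ p → Avoids45 p → ∀ q → Avoids45 q → Compatible₂ x p q →
            Clash x p q 0F 1F ⊎ Clash x p q 2F 3F
    clash = toWitness {a? =
      Fin.all? λ x → Avoids45? x →-dec Fin.all? λ p → Avoids45? p →-dec Fin.all? λ q → Avoids45? q →-dec
      Compatible₂? x p q →-dec (Clash? x p q 0F 1F ⊎-dec Clash? x p q 2F 3F)} tt

  σ-map : ∀ {m n} {f : Fin m → Fin n} → Injective _≡_ _≡_ f → ∀ i k → σ (f i) (f k) ≡ σ i k
  σ-map {f = f} inj i k with i Fin.≟ k
  ... | yes refl rewrite dec-true (f i Fin.≟ f i) refl = refl
  ... | no  i≢k  rewrite dec-false (f i Fin.≟ f k) (i≢k ∘ inj) = refl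

  -- Transfers the check on fixed row numbers to an arbitrary naming of the rows.
  parity-map : ∀ {m n} {f : Fin m → Fin n} → Injective _≡_ _≡_ f → ∀ xs ys →
               parity (List.map f xs) (List.map f ys) ≡ parity xs ys
  parity-map {f = f} inj xs ys = go xs
    where
    against-map : ∀ x ys → against (f x) (List.map f ys) ≡ against x ys
    against-map x []       = refl
    against-map x (y ∷ ys) = cong₂ Sign._*_ (σ-map inj x y) (against-map x ys)
    go : ∀ xs → parity (List.map f xs) (List.map f ys) ≡ parity xs ys
    go []       = refl
    go (x ∷ xs) = cong₂ Sign._*_ (against-map x ys) (go xs)

  open CommutativeSemigroupProperties Sign.*-commutativeSemigroup using (interchange)

  parity-++ˡ : ∀ {n} (xs ys zs : List (Fin n)) → parity (xs ++ ys) zs ≡ parity xs zs Sign.* parity ys zs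
  parity-++ˡ []       ys zs = refl
  parity-++ˡ (x ∷ xs) ys zs =
    trans (cong (against x zs Sign.*_) (parity-++ˡ xs ys zs)) (sym (Sign.*-assoc (against x zs) _ _))

  parity-++ʳ : ∀ {n} (xs ys zs : List (Fin n)) → parity xs (ys ++ zs) ≡ parity xs ys Sign.* parity xs zs
  parity-++ʳ []       ys zs = refl
  parity-++ʳ (x ∷ xs) ys zs = trans (cong₂ Sign._*_ (against-++ ys) (parity-++ʳ xs ys zs))
    (interchange (against x ys) (against x zs) (parity xs ys) (parity xs zs))
    where
    against-++ : ∀ ys → against x (ys ++ zs) ≡ against x ys Sign.* against x zs
    against-++ []       = refl
    against-++ (y ∷ ys) = trans (cong (σ x y Sign.*_) (against-++ ys)) (sym (Sign.*-assoc (σ x y) _ _))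

open Parity

-- Intercalate matrices: no even 10 × 10 matrix in 16 colours

module Intercalation where
  open ≡ using (refl; sym; trans; cong)

  lookup-injective : ∀ {a} {A : Set a} {xs : List A} → Unique xs → Injective _≡_ _≡_ (lookup xs)
  lookup-injective (x∉xs ∷ _)  {zero}  {zero}  _  = refl
  lookup-injective (x∉xs ∷ _)  {zero}  {suc j} eq = contradiction eq (All.lookup x∉xs (∈-lookup j))
  lookup-injective (x∉xs ∷ _)  {suc i} {zero}  eq = contradiction (sym eq) (All.lookup x∉xs (∈-lookup i))
  lookup-injective (_ ∷ xs!)   {suc i} {suc j} eq = cong suc (lookup-injective xs! eq)

  fresh-∷ : ∀ {n} {xs : List (Fin n)} → Unique xs → length xs ℕ.< n → ∃[ x ] Unique (x ∷ xs)
  fresh-∷ {xs = xs} xs! xs<n =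
    let x , x∉xs = fresh xs xs<n
    in x , ¬Any⇒All¬ xs x∉xs ∷ xs!

  lookup-surjective : ∀ {n} {xs : List (Fin n)} → Unique xs → n ℕ.≤ length xs →
                      ∀ x → ∃[ i ] x ≡ lookup xs i
  lookup-surjective {xs = xs} xs! n≤xs x with _∈?_ Fin._≟_ x xs
  ... | yes x∈xs = Any.index x∈xs , lookup-index x∈xs
  ... | no  x∉xs = contradiction
    (Fin.injective⇒≤ (lookup-injective (¬Any⇒All¬ xs x∉xs ∷ xs!))) (ℕ.<⇒≱ (s≤s n≤xs))

  four-shared : {f g : Fin 10 → Fin 16} → Injective _≡_ _≡_ f → Injective _≡_ _≡_ g → 4 ℕ.≤ shared f g
  four-shared f-injective g-injective = ℕ.+-cancelˡ-≤ 16 4 _ (shared-2 f-injective g-injective)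

  -- Both equations concern the same columns `j` and `l`; this is what makes the associated operator
  -- product return to its starting vector. Only the rows are indexed, as parities depend on nothing
  -- else.
  data Relation {r s n} (c : Fin r → Fin s → Fin n) : List (Fin r) → Set where
    relation : ∀ {i k p q j l} → c i j ≡ c k l → c p j ≡ c q l → Relation c (i ∷ k ∷ p ∷ q ∷ [])

  module _
    (c : Fin 10 → Fin 10 → Fin 16)
    (row-injective    : ∀ i → Injective _≡_ _≡_ (c i))
    (column-injective : ∀ j → Injective _≡_ _≡_ (λ i → c i j))
    (intercalate      : ∀ {i j k l} → c i j ≡ c k l → c k j ≡ c i l)
    (even             : ∀ {xs ys} → Relation c xs → Relation c ys → parity xs ys ≡ Sign.+)
    where

    private
      column : Fin 10 → Fin 10 → Fin 16
      column j i = c i j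

      Matched : (j l i k : Fin 10) → Set
      Matched j l i k = c i j ≡ c k l

      matched-≢ : ∀ {j l i k} → j ≢ l → Matched j l i k → i ≢ k
      matched-≢ j≢l m refl = j≢l (row-injective _ m)

      -- For fixed columns, `intercalate` makes matching of rows symmetric and column injectivity
      -- makes the partner unique, so matched rows split into disjoint pairs.
      matched-partners : ∀ {j l i k p q} → Matched j l i k → Matched j l p q →
                         p ≢ i → p ≢ k → q ≢ i × q ≢ k
      matched-partners m m′ p≢i p≢k =
        (λ { refl → p≢k (column-injective _ (trans (sym (intercalate m′)) m)) }) ,
        (λ { refl → p≢i (column-injective _ (trans m′ (sym m))) })

    relation-swap : ∀ {i k p q} → Relation c (i ∷ k ∷ p ∷ q ∷ []) → Relation c (i ∷ k ∷ q ∷ p ∷ [])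
    relation-swap (relation m m′) = relation m (intercalate m′)

    -- Columns j and l in which rows i and k share a colour share at least four colours.
    extend : ∀ {i k} → i ≢ k → ∃[ p ] ∃[ q ] Unique (i ∷ k ∷ p ∷ q ∷ []) × Relation c (i ∷ k ∷ p ∷ q ∷ [])
    extend {i} {k} i≢k =
      let j , _ , l , m = shared-avoiding (row-injective k) [] (ℕ.≤-trans (s≤s z≤n) (four-shared (row-injective i) (row-injective k)))
          p , p∉ , q , m′ = shared-avoiding (column-injective l) (i ∷ k ∷ [])
                              (ℕ.≤-trans (s≤s (s≤s (s≤s z≤n))) (four-shared (column-injective j) (column-injective l)))
          j≢l = λ j≡l → i≢k (column-injective j (trans m (cong (c k) (sym j≡l))))
          p≢i = p∉ ∘ here
          p≢k = p∉ ∘ there ∘ here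
          q≢i , q≢k = matched-partners m m′ p≢i p≢k
      in p , q ,
        ((i≢k ∷ p≢i ∘ sym ∷ q≢i ∘ sym ∷ []) ∷ (p≢k ∘ sym ∷ q≢k ∘ sym ∷ []) ∷
         (matched-≢ j≢l m′ ∷ []) ∷ [] ∷ []) ,
        relation m m′

    module _ {label : Fin 10 → Fin 10} (label-injective : Injective _≡_ _≡_ label)
             (label-surjective : ∀ i → ∃[ x ] i ≡ label x)
             (u₁ : Relation c (List.map label (4F ∷ 5F ∷ 6F ∷ 7F ∷ [])))
             (u₂ : Relation c (List.map label (4F ∷ 5F ∷ 8F ∷ 9F ∷ []))) where

      private
        even′ : ∀ {xs ys} → Relation c (List.map label xs) → Relation c (List.map label ys) → parity xs ys ≡ Sign.+
        even′ {xs} {ys} u v = trans (sym (parity-map label-injective xs ys)) (even u v)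

        extend′ : ∀ x → 4F ≢ x →
                  ∃[ s ] s ≢ 4F × ∃[ t ] s < t × t ≢ 4F × Relation c (List.map label (4F ∷ x ∷ s ∷ t ∷ []))
        extend′ x 4≢x with extend (4≢x ∘ label-injective)
        ... | s , t , (_ ∷ 4≢s ∷ 4≢t ∷ []) ∷ _ ∷ (s≢t ∷ []) ∷ _ , u
          with s′ , refl ← label-surjective s | t′ , refl ← label-surjective t
          -- `Clash` covers ordered completions only; `relation-swap` supplies the other order.
          with Fin.<-cmp s′ t′
        ... | tri< s<t _ _ = s′ , 4≢s ∘ cong label ∘ sym , t′ , s<t , 4≢t ∘ cong label ∘ sym , u
        ... | tri≈ _ s≡t _ = contradiction (cong label s≡t) s≢t
        ... | tri> _ _ t<s = t′ , 4≢t ∘ cong label ∘ sym , s′ , t<s , 4≢s ∘ cong label ∘ sym , relation-swap u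

        no-clash : ∀ {x y z} → Relation c (List.map label (4F ∷ x ∷ y ∷ z ∷ [])) →
                   ∀ i k → 4F ≢ i → 4F ≢ k → ¬ Clash x y z i k
        no-clash u₃ i k 4≢i 4≢k clashes =
          let s  , s≢4  , t  , s<t   , t≢4  , v = extend′ i 4≢i
              s′ , s′≢4 , t′ , s′<t′ , t′≢4 , w = extend′ k 4≢k
          in case trans (sym (even′ v w))
               (clashes s s≢4 t s<t t≢4 ((even′ u₁ v , even′ u₂ v) , even′ u₃ v)
                        s′ s′≢4 t′ s′<t′ t′≢4 ((even′ u₁ w , even′ u₂ w) , even′ u₃ w)) of λ ()

      -- For the two rows that `clash` singles out, `extend′` produces quadruples through 4. They
      -- would meet oddly by `Clash`, evenly by `even`.
      no-third-labelled : ∀ x y z → Avoids45 x → Avoids45 y → Avoids45 z →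
                          ¬ Relation c (List.map label (4F ∷ x ∷ y ∷ z ∷ []))
      no-third-labelled x y z x! y! z! u₃
        with clash x x! y y! z z! (even′ u₁ u₃ , even′ u₂ u₃)
      ... | inj₁ clashes = no-clash u₃ 0F 1F (λ ()) (λ ()) clashes
      ... | inj₂ clashes = no-clash u₃ 2F 3F (λ ()) (λ ()) clashes

    -- The combinatorial core: two quadruples that meet exactly in the pair `i`, `k` exclude a third
    -- one through `i` that avoids `k`. It is `clash` after a renaming of rows.
    no-third : ∀ {i k p q r s} → Unique (i ∷ k ∷ p ∷ q ∷ r ∷ s ∷ []) →
               Relation c (i ∷ k ∷ p ∷ q ∷ []) → Relation c (i ∷ k ∷ r ∷ s ∷ []) →
               ∀ {x y z} → x ≢ i × x ≢ k → y ≢ i × y ≢ k → z ≢ i × z ≢ k →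
               ¬ Relation c (i ∷ x ∷ y ∷ z ∷ [])
    no-third six! u₁ u₂ {x} {y} {z} x! y! z! u₃ =
      -- Prepending the four remaining rows puts the given six at positions 4 to 9 and the others at
      -- 0 to 3, the numbering used by `clash`.
      let _ , seven! = fresh-∷ six!   (ℕ.m≤m+n 7 3)
          _ , eight! = fresh-∷ seven! (ℕ.m≤m+n 8 2)
          _ , nine!  = fresh-∷ eight! (ℕ.m≤m+n 9 1)
          _ , ten!   = fresh-∷ nine!  (ℕ.m≤m+n 10 0)
      in relabelled (lookup-injective ten!) (lookup-surjective ten! ℕ.≤-refl) u₁ u₂ x! y! z! u₃
      where
      relabelled : ∀ {label : Fin 10 → Fin 10} → Injective _≡_ _≡_ label → (∀ i → ∃[ x ] i ≡ label x) →
        Relation c (List.map label (4F ∷ 5F ∷ 6F ∷ 7F ∷ [])) → Relation c (List.map label (4F ∷ 5F ∷ 8F ∷ 9F ∷ [])) →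
        ∀ {x y z} → x ≢ label 4F × x ≢ label 5F → y ≢ label 4F × y ≢ label 5F → z ≢ label 4F × z ≢ label 5F →
        ¬ Relation c (label 4F ∷ x ∷ y ∷ z ∷ [])
      relabelled {label} injective onto u₁ u₂ {x} {y} {z} x! y! z! u₃
        with x′ , refl ← onto x | y′ , refl ← onto y | z′ , refl ← onto z
        = no-third-labelled injective onto u₁ u₂ x′ y′ z′ (avoids x!) (avoids y!) (avoids z!) u₃
        where
        avoids : ∀ {x} → label x ≢ label 4F × label x ≢ label 5F → Avoids45 x
        avoids (≢4 , ≢5) = ≢4 ∘ cong label , ≢5 ∘ cong label

    -- Five is one more than the guaranteed four. It allows a matched row to be found outside two
    -- matched pairs, hence a third pair.
    Heavy : (j l : Fin 10) → Set
    Heavy j l = 5 ℕ.≤ shared (column j) (column l)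

    Heavy? : ∀ j l → Dec (Heavy j l)
    Heavy? j l = 5 ℕ.≤? _

    -- Three columns have 30 entries, in only 16 colours.
    heavy-among-three : ∀ {j l m} → ¬ Heavy j l → ¬ Heavy j m → Heavy l m
    heavy-among-three {j} {l} {m} ¬jl ¬jm = ℕ.≰⇒> λ lm≤4 → ℕ.<⇒≱ (ℕ.m≤m+n 29 1) (ℕ.≤-trans
      (shared-3 (column-injective j) (column-injective l) (column-injective m))
      (ℕ.+-monoʳ-≤ 16 (ℕ.+-mono-≤ (ℕ.s≤s⁻¹ (ℕ.≰⇒> ¬jl)) (ℕ.+-mono-≤ lm≤4 (ℕ.s≤s⁻¹ (ℕ.≰⇒> ¬jm))))))

    record TwoHeavy : Set where
      constructor two-heavy
      field
        {j l l′} : Fin 10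
        j≢l      : j ≢ l
        j≢l′     : j ≢ l′
        l≢l′     : l ≢ l′
        heavy    : Heavy j l
        heavy′   : Heavy j l′

    -- Three columns that are light with j are heavy with one another.
    light-with-three : ∀ {j l m n} → l ≢ m → l ≢ n → m ≢ n → ¬ Heavy j l → ¬ Heavy j m → ¬ Heavy j n → TwoHeavy
    light-with-three l≢m l≢n m≢n ¬jl ¬jm ¬jn =
      two-heavy l≢m l≢n m≢n (heavy-among-three ¬jl ¬jm) (heavy-among-three ¬jl ¬jn)

    -- Of the columns 1 to 4, either two are heavy with column 0 or three are light with it, and
    -- `light-with-three` settles the second case.
    two-heavy-partners : TwoHeavy
    two-heavy-partners with Heavy? 0F 1F | Heavy? 0F 2F | Heavy? 0F 3F | Heavy? 0F 4F
    ... | yes h | yes h′ | _ | _ = two-heavy (λ ()) (λ ()) (λ ()) h h′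
    ... | yes h | no _ | yes h′ | _ = two-heavy (λ ()) (λ ()) (λ ()) h h′
    ... | yes h | no _ | no _ | yes h′ = two-heavy (λ ()) (λ ()) (λ ()) h h′
    ... | yes _ | no ¬a | no ¬b | no ¬c = light-with-three (λ ()) (λ ()) (λ ()) ¬a ¬b ¬c
    ... | no _ | yes h | yes h′ | _ = two-heavy (λ ()) (λ ()) (λ ()) h h′
    ... | no _ | yes h | no _ | yes h′ = two-heavy (λ ()) (λ ()) (λ ()) h h′
    ... | no ¬a | yes _ | no ¬b | no ¬c = light-with-three (λ ()) (λ ()) (λ ()) ¬a ¬b ¬c
    ... | no _ | no _ | yes h | yes h′ = two-heavy (λ ()) (λ ()) (λ ()) h h′
    ... | no ¬a | no ¬b | no ¬c | _ = light-with-three (λ ()) (λ ()) (λ ()) ¬a ¬b ¬c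
    ... | no ¬a | no ¬b | yes _ | no ¬c = light-with-three (λ ()) (λ ()) (λ ()) ¬a ¬b ¬c

    three-pairs : ∀ {j l i k} → j ≢ l → Heavy j l → Matched j l i k →
      ∃[ p ] ∃[ q ] ∃[ r ] ∃[ s ] Unique (i ∷ k ∷ p ∷ q ∷ r ∷ s ∷ []) × Matched j l p q × Matched j l r s
    three-pairs {j} {l} {i} {k} j≢l heavy m =
      let p , p∉ , q , m₁ = shared-avoiding (column-injective l) (i ∷ k ∷ []) (ℕ.≤-trans (ℕ.m≤m+n 3 2) heavy)
          r , r∉ , s , m₂ = shared-avoiding (column-injective l) (i ∷ k ∷ p ∷ q ∷ []) heavy
          p≢i = p∉ ∘ here
          p≢k = p∉ ∘ there ∘ here
          r≢i = r∉ ∘ here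
          r≢k = r∉ ∘ there ∘ here
          r≢p = r∉ ∘ there ∘ there ∘ here
          r≢q = r∉ ∘ there ∘ there ∘ there ∘ here
          q≢i , q≢k = matched-partners m m₁ p≢i p≢k
          s≢i , s≢k = matched-partners m m₂ r≢i r≢k
          s≢p , s≢q = matched-partners m₁ m₂ r≢p r≢q
      in p , q , r , s ,
        ((matched-≢ j≢l m ∷ p≢i ∘ sym ∷ q≢i ∘ sym ∷ r≢i ∘ sym ∷ s≢i ∘ sym ∷ []) ∷
         (p≢k ∘ sym ∷ q≢k ∘ sym ∷ r≢k ∘ sym ∷ s≢k ∘ sym ∷ []) ∷
         (matched-≢ j≢l m₁ ∷ r≢p ∘ sym ∷ s≢p ∘ sym ∷ []) ∷
         (r≢q ∘ sym ∷ s≢q ∘ sym ∷ []) ∷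
         (matched-≢ j≢l m₂ ∷ []) ∷ [] ∷ []) ,
        m₁ , m₂

    -- The six rows matched between j and l leave out four, fewer than are matched between j and l′.
    common-row : ∀ {j l l′} → j ≢ l → Heavy j l → Heavy j l′ →
                 ∃[ i ] (∃[ k ] Matched j l i k) × (∃[ x ] Matched j l′ i x)
    common-row {j} {l} {l′} j≢l heavy heavy′ =
      let _ , _ , _ , m = shared-avoiding (column-injective l) [] (ℕ.≤-trans (s≤s z≤n) heavy)
          _ , _ , _ , _ , six! , m₁ , m₂ = three-pairs j≢l heavy m
          a , seven! = fresh-∷ six!   (ℕ.m≤m+n 7 3)
          b , eight! = fresh-∷ seven! (ℕ.m≤m+n 8 2)
          d , nine!  = fresh-∷ eight! (ℕ.m≤m+n 9 1)
          e , ten!   = fresh-∷ nine!  (ℕ.m≤m+n 10 0)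
          i , i∉ , matched′ = shared-avoiding (column-injective l′) (e ∷ d ∷ b ∷ a ∷ []) heavy′
      in i , locate m m₁ m₂ i∉ (lookup-surjective ten! ℕ.≤-refl i) , matched′
      where
      locate : ∀ {a b d e i k p q r s x} → Matched j l i k → Matched j l p q → Matched j l r s →
               x ∉ e ∷ d ∷ b ∷ a ∷ [] →
               (∃[ y ] x ≡ lookup (e ∷ d ∷ b ∷ a ∷ i ∷ k ∷ p ∷ q ∷ r ∷ s ∷ []) y) →
               ∃[ k ] Matched j l x k
      locate m m₁ m₂ x∉ (0F , refl) = contradiction (here refl) x∉
      locate m m₁ m₂ x∉ (1F , refl) = contradiction (there (here refl)) x∉
      locate m m₁ m₂ x∉ (2F , refl) = contradiction (there (there (here refl))) x∉
      locate m m₁ m₂ x∉ (3F , refl) = contradiction (there (there (there (here refl)))) x∉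
      locate m m₁ m₂ x∉ (4F , refl) = _ , m
      locate m m₁ m₂ x∉ (5F , refl) = _ , intercalate m
      locate m m₁ m₂ x∉ (6F , refl) = _ , m₁
      locate m m₁ m₂ x∉ (7F , refl) = _ , intercalate m₁
      locate m m₁ m₂ x∉ (8F , refl) = _ , m₂
      locate m m₁ m₂ x∉ (9F , refl) = _ , intercalate m₂

    -- Columns `j`, `l` give two quadruples on the pair `i`, `k`. Columns `j`, `l′`, matched at the
    -- same row `i`, give the third quadruple, which has to avoid `k`.
    no-10×10-in-16 : ⊥
    no-10×10-in-16 =
      let two-heavy j≢l j≢l′ l≢l′ heavy heavy′ = two-heavy-partners
          i , (k , m) , x , m′ = common-row j≢l heavy heavy′
          _ , _ , _ , _ , six! , m₁ , m₂ = three-pairs j≢l heavy m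
          y , z , v , w , six′! , n₁ , n₂ = three-pairs j≢l′ heavy′ m′
      in conclude l≢l′ m m₁ m₂ m′ n₁ n₂ six! six′! (y Fin.≟ k) (z Fin.≟ k)
      where
      conclude : ∀ {j l l′ i k p q r s x y z v w} → l ≢ l′ →
        Matched j l i k → Matched j l p q → Matched j l r s →
        Matched j l′ i x → Matched j l′ y z → Matched j l′ v w →
        Unique (i ∷ k ∷ p ∷ q ∷ r ∷ s ∷ []) → Unique (i ∷ x ∷ y ∷ z ∷ v ∷ w ∷ []) →
        Dec (y ≡ k) → Dec (z ≡ k) → ⊥
      conclude {j} {l} {l′} {k = k} {x = x} l≢l′ m m₁ m₂ m′ n₁ n₂ six!
               ((i≢x ∷ i≢y ∷ i≢z ∷ i≢v ∷ i≢w ∷ []) ∷ _ ∷ (_ ∷ y≢v ∷ y≢w ∷ []) ∷ (z≢v ∷ z≢w ∷ []) ∷ _) = go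
        where
        x! : x ≢ _ × x ≢ k
        -- If `x` were `k`, row `k` would contain the colour `c i j` in both columns `l` and `l′`.
        x! = i≢x ∘ sym , λ { refl → l≢l′ (row-injective k (trans (sym m) m′)) }
        -- The pairs `y`, `z` and `v`, `w` are disjoint, so at least one of them misses `k` and can
        -- complete `i`, `x`.
        go : Dec _ → Dec _ → ⊥
        go (no y≢k) (no z≢k) = no-third six! (relation m m₁) (relation m m₂)
          x! (i≢y ∘ sym , y≢k) (i≢z ∘ sym , z≢k) (relation m′ n₁)
        go (yes refl) _ = no-third six! (relation m m₁) (relation m m₂)
          x! (i≢v ∘ sym , y≢v ∘ sym) (i≢w ∘ sym , y≢w ∘ sym) (relation m′ n₂)
        go _ (yes refl) = no-third six! (relation m m₁) (relation m m₂)
          x! (i≢v ∘ sym , z≢v ∘ sym) (i≢w ∘ sym , z≢w ∘ sym) (relation m′ n₂)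

open Intercalation using (Relation; relation; four-shared; no-10×10-in-16)

-- Linear algebra with an inner product over a commutative ring

module EuclideanSpace (R : CommutativeRing 0ℓ 0ℓ) where
  open CommutativeRing R hiding (zero)
  open SemiringSum semiring
  open RingProperties ring using (-1*x≈-x; -‿involutive; +-cancelˡ; +-cancelʳ)
  open SetoidReasoning setoid

  private
    variable
      l m n : ℕ

    V : ℕ → Set
    V = Vector Carrier

  infix 4 _≋_
  _≋_ : V n → V n → Set
  u ≋ v = ∀ i → u i ≈ v i

  infixr 7 _·_
  _·_ : Carrier → V n → V n
  (a · v) i = a * v i

  infixl 6 _⊕_
  _⊕_ : V n → V n → V n
  (u ⊕ v) i = u i + v i

  infixl 7 _⊙_
  _⊙_ : V n → V n → V n
  (u ⊙ v) i = u i * v i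

  ⟨_,_⟩ : V n → V n → Carrier
  ⟨ u , v ⟩ = sum (u ⊙ v)

  e : Fin n → V n
  e i j = if does (i Fin.≟ j) then 1# else 0#

  sum-cong : {f g : V n} → (∀ i → f i ≈ g i) → sum f ≈ sum g
  sum-cong = sum-cong-≋

  ⟨⟩-cong : {u u′ v v′ : V n} → u ≋ u′ → v ≋ v′ → ⟨ u , v ⟩ ≈ ⟨ u′ , v′ ⟩
  ⟨⟩-cong u≋u′ v≋v′ = sum-cong λ i → *-cong (u≋u′ i) (v≋v′ i)

  ⟨⟩-sym : (u v : V n) → ⟨ u , v ⟩ ≈ ⟨ v , u ⟩
  ⟨⟩-sym u v = sum-cong λ i → *-comm (u i) (v i)

  ⟨⟩-⊕ˡ : (u v w : V n) → ⟨ u ⊕ v , w ⟩ ≈ ⟨ u , w ⟩ + ⟨ v , w ⟩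
  ⟨⟩-⊕ˡ u v w = trans (sum-cong λ i → distribʳ (w i) (u i) (v i)) (∑-distrib-+ (u ⊙ w) (v ⊙ w))

  ⟨⟩-⊕ʳ : (u v w : V n) → ⟨ u , v ⊕ w ⟩ ≈ ⟨ u , v ⟩ + ⟨ u , w ⟩
  ⟨⟩-⊕ʳ u v w = trans (sum-cong λ i → distribˡ (u i) (v i) (w i)) (∑-distrib-+ (u ⊙ v) (u ⊙ w))

  ⟨⟩-·ˡ : ∀ a (u v : V n) → ⟨ a · u , v ⟩ ≈ a * ⟨ u , v ⟩
  ⟨⟩-·ˡ a u v = trans (sum-cong λ i → *-assoc a (u i) (v i)) (sym (*-distribˡ-sum a (u ⊙ v)))

  ⟨⟩-·ʳ : ∀ a (u v : V n) → ⟨ u , a · v ⟩ ≈ a * ⟨ u , v ⟩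
  ⟨⟩-·ʳ a u v = trans (⟨⟩-sym u (a · v)) (trans (⟨⟩-·ˡ a v u) (*-congˡ (⟨⟩-sym v u)))

  ⟨e,⟩ : ∀ i (v : V n) → ⟨ e i , v ⟩ ≈ v i
  ⟨e,⟩ zero v = begin
    1# * v zero + sum (λ j → 0# * v (suc j))
      ≈⟨ +-cong (*-identityˡ _) (trans (sym (*-distribˡ-sum 0# (tail v))) (zeroˡ _)) ⟩
    v zero + 0#
      ≈⟨ +-identityʳ _ ⟩
    v zero ∎
  ⟨e,⟩ (suc i) v = trans (+-cong (zeroˡ _) (⟨e,⟩ i (tail v))) (+-identityˡ _)

  e-≡ : ∀ (i : Fin n) → e i i ≈ 1#
  e-≡ i rewrite dec-true (i Fin.≟ i) ≡.refl = refl

  e-≢ : ∀ {i j : Fin n} → i ≢ j → e i j ≈ 0#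
  e-≢ {i = i} {j} i≢j rewrite dec-false (i Fin.≟ j) i≢j = refl

  ⟨e,e⟩-≡ : ∀ (i : Fin n) → ⟨ e i , e i ⟩ ≈ 1#
  ⟨e,e⟩-≡ i = trans (⟨e,⟩ i (e i)) (e-≡ i)

  ⟨e,e⟩-≢ : ∀ {i j : Fin n} → i ≢ j → ⟨ e i , e j ⟩ ≈ 0#
  ⟨e,e⟩-≢ {i = i} {j} i≢j = trans (⟨e,⟩ i (e j)) (e-≢ (i≢j ∘ ≡.sym))

  ∣⊕∣² : (u v : V n) → ⟨ u ⊕ v , u ⊕ v ⟩ ≈ (⟨ u , u ⟩ + ⟨ v , v ⟩) + (⟨ u , v ⟩ + ⟨ u , v ⟩)
  ∣⊕∣² u v = begin
    ⟨ u ⊕ v , u ⊕ v ⟩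
      ≈⟨ trans (⟨⟩-⊕ˡ u v (u ⊕ v)) (+-cong (⟨⟩-⊕ʳ u u v) (⟨⟩-⊕ʳ v u v)) ⟩
    (⟨ u , u ⟩ + ⟨ u , v ⟩) + (⟨ v , u ⟩ + ⟨ v , v ⟩)
      ≈⟨ +-congˡ (+-congʳ (⟨⟩-sym v u)) ⟩
    (⟨ u , u ⟩ + ⟨ u , v ⟩) + (⟨ u , v ⟩ + ⟨ v , v ⟩)
      ≈⟨ solve 3 (λ a b c → (a :+ b) :+ (b :+ c) := (a :+ c) :+ (b :+ b)) refl _ _ _ ⟩
    (⟨ u , u ⟩ + ⟨ v , v ⟩) + (⟨ u , v ⟩ + ⟨ u , v ⟩) ∎
    where open SemiringSolver commutativeSemiring

  record Linear (f : V m → V n) : Set where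
    field
      resp  : ∀ {u v} → u ≋ v → f u ≋ f v
      homo⊕ : ∀ u v → f (u ⊕ v) ≋ f u ⊕ f v
      homo· : ∀ a v → f (a · v) ≋ a · f v

  open Linear

  ∘-linear : {f : V m → V n} {g : V l → V m} → Linear f → Linear g → Linear (f ∘ g)
  ∘-linear F G = record
    { resp  = λ u≋v → resp F (resp G u≋v)
    ; homo⊕ = λ u v i → trans (resp F (homo⊕ G u v) i) (homo⊕ F _ _ i)
    ; homo· = λ a v i → trans (resp F (homo· G a v) i) (homo· F a _ i)
    }

  record Functional (φ : V n → Carrier) : Set where
    field
      cong  : ∀ {u v} → u ≋ v → φ u ≈ φ v
      homo+ : ∀ u v → φ (u ⊕ v) ≈ φ u + φ v
      homo* : ∀ a v → φ (a · v) ≈ a * φ v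

  functional-expansion : {φ : V n → Carrier} → Functional φ → ∀ v → φ v ≈ sum λ i → v i * φ (e i)
  functional-expansion {zero} {φ} Φ v = begin
    φ v          ≈⟨ cong (λ ()) ⟩
    φ (0# · v)   ≈⟨ homo* 0# v ⟩
    0# * φ v     ≈⟨ zeroˡ _ ⟩
    0#           ∎
    where open Functional Φ
  functional-expansion {suc n} {φ} Φ v = begin
    φ v                                          ≈⟨ cong split ⟩
    φ (v zero · e zero ⊕ (0# ∷ᵛ tail v))         ≈⟨ homo+ _ _ ⟩
    φ (v zero · e zero) + φ (0# ∷ᵛ tail v)       ≈⟨ +-cong (homo* _ _) (functional-expansion Φ′ (tail v)) ⟩
    v zero * φ (e zero) + sum (λ i → v (suc i) * φ (0# ∷ᵛ e i))
      ≈⟨ +-congˡ (sum-cong λ i → *-congˡ (cong {0# ∷ᵛ e i} {e (suc i)} λ { zero → refl ; (suc j) → refl })) ⟩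
    sum (λ i → v i * φ (e i))                    ∎
    where
    open Functional Φ
    split : v ≋ v zero · e zero ⊕ (0# ∷ᵛ tail v)
    split zero    = sym (trans (+-identityʳ _) (*-identityʳ _))
    split (suc i) = sym (trans (+-congʳ (zeroʳ _)) (+-identityˡ _))
    Φ′ : Functional (φ ∘ (0# ∷ᵛ_))
    Φ′ = record
      { cong  = λ u≋v → cong λ { zero → refl ; (suc i) → u≋v i }
      ; homo+ = λ u v → trans (cong λ { zero → sym (+-identityˡ _) ; (suc i) → refl }) (homo+ _ _)
      ; homo* = λ a v → trans (cong λ { zero → sym (zeroʳ _) ; (suc i) → refl }) (homo* _ _)
      }

  transpose : (V m → V n) → V n → V m
  transpose f v j = ⟨ f (e j) , v ⟩

  transpose-linear : (f : V m → V n) → Linear (transpose f)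
  transpose-linear f = record
    { resp  = λ u≋v j → ⟨⟩-cong (λ _ → refl) u≋v
    ; homo⊕ = λ u v j → ⟨⟩-⊕ʳ (f (e j)) u v
    ; homo· = λ a v j → ⟨⟩-·ʳ a (f (e j)) v
    }

  transpose-⟨⟩ : {f : V m → V n} → Linear f → ∀ u v → ⟨ f u , v ⟩ ≈ ⟨ u , transpose f v ⟩
  transpose-⟨⟩ {f = f} F u v = functional-expansion (record
    { cong  = λ u≋u′ → ⟨⟩-cong (resp F u≋u′) (λ _ → refl)
    ; homo+ = λ a b → trans (⟨⟩-cong (homo⊕ F a b) (λ _ → refl)) (⟨⟩-⊕ˡ (f a) (f b) v)
    ; homo* = λ a b → trans (⟨⟩-cong (homo· F a b) (λ _ → refl)) (⟨⟩-·ˡ a (f b) v)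
    }) u

  sgn : Sign → Carrier
  sgn Sign.+ = 1#
  sgn Sign.- = - 1#

  sgn-* : ∀ s t → sgn (s Sign.* t) ≈ sgn s * sgn t
  sgn-* Sign.+ t      = sym (*-identityˡ _)
  sgn-* Sign.- Sign.+ = sym (*-identityʳ _)
  sgn-* Sign.- Sign.- = sym (trans (-1*x≈-x _) (-‿involutive _))

  sgn-·-* : ∀ s t (v : V n) → sgn s · sgn t · v ≋ sgn (s Sign.* t) · v
  sgn-·-* s t v i = trans (sym (*-assoc _ _ _)) (*-congʳ (sym (sgn-* s t)))

  infix 4 _∼_
  _∼_ : V n → V n → Set
  u ∼ v = ∃[ s ] u ≋ sgn s · v

  ≋⇒∼ : {u v : V n} → u ≋ v → u ∼ v
  ≋⇒∼ u≋v = Sign.+ , λ i → trans (u≋v i) (sym (*-identityˡ _))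

  ∼-sym : {u v : V n} → u ∼ v → v ∼ u
  ∼-sym {u = u} {v} (s , u≋sv) = s , λ i → sym (begin
    sgn s * u i             ≈⟨ *-congˡ (u≋sv i) ⟩
    sgn s * (sgn s * v i)   ≈⟨ sgn-·-* s s v i ⟩
    sgn (s Sign.* s) * v i  ≡⟨ ≡.cong (λ t → sgn t * v i) (Sign.s*s≡+ s) ⟩
    1# * v i                ≈⟨ *-identityˡ _ ⟩
    v i                     ∎)

  ∼-trans : {u v w : V n} → u ∼ v → v ∼ w → u ∼ w
  ∼-trans {w = w} (s , u≋sv) (t , v≋tw) =
    s Sign.* t , λ i → trans (u≋sv i) (trans (*-congˡ (v≋tw i)) (sgn-·-* s t w i))

  linear-∼ : {f : V m → V n} → Linear f → ∀ {u v} → u ∼ v → f u ∼ f v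
  linear-∼ F (s , u≋sv) = s , λ i → trans (resp F u≋sv i) (homo· F (sgn s) _ i)

  -- Apart from `1 ≉ 0`, these are the two facts about the reals that the linear algebra needs
  -- beyond the ring axioms: 2 can be cancelled, and a vanishing sum of squares has vanishing terms.
  module Orthogonality
    (double-injective : ∀ {x y} → x + x ≈ y + y → x ≈ y)
    (squares≈0 : ∀ {m n} (M : Fin m → V n) → sum (λ a → ⟨ M a , M a ⟩) ≈ 0# → ∀ a → M a ≋ λ _ → 0#)
    where

    -- The factor `c` is `1#` for isometries and ∣x∣² for the map `F x` with arbitrary `x`.
    polarise : {f : V m → V n} → Linear f → ∀ c → (∀ v → ⟨ f v , f v ⟩ ≈ c * ⟨ v , v ⟩) →
               ∀ u v → ⟨ f u , f v ⟩ ≈ c * ⟨ u , v ⟩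
    polarise {f = f} F c norm u v = double-injective (+-cancelˡ (⟨ f u , f u ⟩ + ⟨ f v , f v ⟩) _ _ (begin
      (⟨ f u , f u ⟩ + ⟨ f v , f v ⟩) + (⟨ f u , f v ⟩ + ⟨ f u , f v ⟩)
        ≈⟨ ∣⊕∣² (f u) (f v) ⟨
      ⟨ f u ⊕ f v , f u ⊕ f v ⟩
        ≈⟨ ⟨⟩-cong (homo⊕ F u v) (homo⊕ F u v) ⟨
      ⟨ f (u ⊕ v) , f (u ⊕ v) ⟩
        ≈⟨ norm (u ⊕ v) ⟩
      c * ⟨ u ⊕ v , u ⊕ v ⟩
        ≈⟨ *-congˡ (∣⊕∣² u v) ⟩
      c * ((⟨ u , u ⟩ + ⟨ v , v ⟩) + (⟨ u , v ⟩ + ⟨ u , v ⟩))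
        ≈⟨ solve 4 (λ c a b d → c :* ((a :+ b) :+ (d :+ d)) := (c :* a :+ c :* b) :+ (c :* d :+ c :* d))
             refl c _ _ _ ⟩
      (c * ⟨ u , u ⟩ + c * ⟨ v , v ⟩) + (c * ⟨ u , v ⟩ + c * ⟨ u , v ⟩)
        ≈⟨ +-congʳ (+-cong (norm u) (norm v)) ⟨
      (⟨ f u , f u ⟩ + ⟨ f v , f v ⟩) + (c * ⟨ u , v ⟩ + c * ⟨ u , v ⟩) ∎))
      where open SemiringSolver commutativeSemiring

    record Isometry (f : V m → V n) : Set where
      field
        linear    : Linear f
        preserves : ∀ u v → ⟨ f u , f v ⟩ ≈ ⟨ u , v ⟩

    isometry : {f : V m → V n} → Linear f → (∀ v → ⟨ f v , f v ⟩ ≈ ⟨ v , v ⟩) → Isometry f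
    isometry F norm = record
      { linear    = F
      ; preserves = λ u v → trans
          (polarise F 1# (λ w → trans (norm w) (sym (*-identityˡ _))) u v) (*-identityˡ _)
      }

    module _ {f : V m → V n} (F : Isometry f) where
      open Isometry F

      transpose-inverseˡ : ∀ v → transpose f (f v) ≋ v
      transpose-inverseˡ v j = trans (preserves (e j) v) (⟨e,⟩ j v)

    -- For a square isometry f let w a = fᵀ (e a).  Then ∣ f (w a) - e a ∣² + ∣ w a ∣² = 1, and
    -- summing over a gives n on the right and, by exchanging the sums, ∑ ∣ w a ∣² = n.
    module _ {f : V n → V n} (F : Isometry f) where
      open Isometry F

      private
        w r : Fin n → V n
        w a = transpose f (e a)
        r a i = f (w a) i + - e a i

        r⊕e : ∀ a → r a ⊕ e a ≋ f (w a)
        r⊕e a i = trans (+-assoc _ _ _) (trans (+-congˡ (-‿inverseˡ _)) (+-identityʳ _))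

        ∣r∣²+∣w∣² : ∀ a → ⟨ r a , r a ⟩ + ⟨ w a , w a ⟩ ≈ 1#
        ∣r∣²+∣w∣² a = +-cancelʳ ⟨ r a , e a ⟩ _ _ (begin
          (⟨ r a , r a ⟩ + ⟨ w a , w a ⟩) + ⟨ r a , e a ⟩
            ≈⟨ +-congʳ (+-congˡ re+1) ⟨
          (⟨ r a , r a ⟩ + (⟨ r a , e a ⟩ + 1#)) + ⟨ r a , e a ⟩
            ≈⟨ solve 2 (λ x y → (x :+ (y :+ con 1)) :+ y := (x :+ con 1) :+ (y :+ y)) refl _ _ ⟩
          (⟨ r a , r a ⟩ + 1#) + (⟨ r a , e a ⟩ + ⟨ r a , e a ⟩)
            ≈⟨ +-congʳ (+-congˡ (⟨e,e⟩-≡ a)) ⟨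
          (⟨ r a , r a ⟩ + ⟨ e a , e a ⟩) + (⟨ r a , e a ⟩ + ⟨ r a , e a ⟩)
            ≈⟨ ∣⊕∣² (r a) (e a) ⟨
          ⟨ r a ⊕ e a , r a ⊕ e a ⟩
            ≈⟨ trans (⟨⟩-cong (r⊕e a) (r⊕e a)) (preserves (w a) (w a)) ⟩
          ⟨ w a , w a ⟩
            ≈⟨ re+1 ⟨
          ⟨ r a , e a ⟩ + 1#
            ≈⟨ +-comm _ _ ⟩
          1# + ⟨ r a , e a ⟩ ∎)
          where
          open SemiringSolver commutativeSemiring
          re+1 : ⟨ r a , e a ⟩ + 1# ≈ ⟨ w a , w a ⟩
          re+1 = begin
            ⟨ r a , e a ⟩ + 1#             ≈⟨ +-congˡ (⟨e,e⟩-≡ a) ⟨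
            ⟨ r a , e a ⟩ + ⟨ e a , e a ⟩  ≈⟨ ⟨⟩-⊕ˡ (r a) (e a) (e a) ⟨
            ⟨ r a ⊕ e a , e a ⟩            ≈⟨ ⟨⟩-cong (r⊕e a) (λ _ → refl) ⟩
            ⟨ f (w a) , e a ⟩              ≈⟨ transpose-⟨⟩ linear (w a) (e a) ⟩
            ⟨ w a , w a ⟩                  ∎

        ∑∣w∣² : sum (λ a → ⟨ w a , w a ⟩) ≈ sum {n} λ _ → 1#
        ∑∣w∣² = begin
          sum (λ a → sum λ j → w a j * w a j)
            ≈⟨ sum-cong (λ a → sum-cong λ j → *-cong (entry a j) (entry a j)) ⟩
          sum (λ a → sum λ j → f (e j) a * f (e j) a)
            ≈⟨ ∑-comm (λ a j → f (e j) a * f (e j) a) ⟩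
          sum (λ j → ⟨ f (e j) , f (e j) ⟩)
            ≈⟨ sum-cong (λ j → trans (preserves (e j) (e j)) (⟨e,e⟩-≡ j)) ⟩
          sum {n} (λ _ → 1#) ∎
          where
          entry : ∀ a j → w a j ≈ f (e j) a
          entry a j = trans (⟨⟩-sym (f (e j)) (e a)) (⟨e,⟩ a (f (e j)))

        ∑∣r∣² : sum (λ a → ⟨ r a , r a ⟩) ≈ 0#
        ∑∣r∣² = +-cancelʳ (sum λ a → ⟨ w a , w a ⟩) _ _ (begin
          sum (λ a → ⟨ r a , r a ⟩) + sum (λ a → ⟨ w a , w a ⟩)
            ≈⟨ ∑-distrib-+ (λ a → ⟨ r a , r a ⟩) (λ a → ⟨ w a , w a ⟩) ⟨
          sum (λ a → ⟨ r a , r a ⟩ + ⟨ w a , w a ⟩)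
            ≈⟨ sum-cong ∣r∣²+∣w∣² ⟩
          sum {n} (λ _ → 1#)
            ≈⟨ trans (+-identityˡ _) ∑∣w∣² ⟨
          0# + sum (λ a → ⟨ w a , w a ⟩) ∎)

        f-w : ∀ a → f (w a) ≋ e a
        f-w a i = trans (sym (r⊕e a i)) (trans (+-congʳ (squares≈0 r ∑∣r∣² a i)) (+-identityˡ _))

      transpose-inverseʳ : ∀ v → f (transpose f v) ≋ v
      transpose-inverseʳ v a = begin
        f (transpose f v) a                ≈⟨ ⟨e,⟩ a _ ⟨
        ⟨ e a , f (transpose f v) ⟩        ≈⟨ ⟨⟩-sym (e a) _ ⟩
        ⟨ f (transpose f v) , e a ⟩        ≈⟨ transpose-⟨⟩ linear _ (e a) ⟩
        ⟨ transpose f v , w a ⟩            ≈⟨ ⟨⟩-sym _ (w a) ⟩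
        ⟨ w a , transpose f v ⟩            ≈⟨ transpose-⟨⟩ linear (w a) v ⟨
        ⟨ f (w a) , v ⟩                    ≈⟨ ⟨⟩-cong (f-w a) (λ _ → refl) ⟩
        ⟨ e a , v ⟩                        ≈⟨ ⟨e,⟩ a v ⟩
        v a                                ∎

    -- Operators that commute up to sign

    Commutes : Sign → (f g : V n → V n) → Set
    Commutes s f g = ∀ v → f (g v) ≋ sgn s · g (f v)

    commutes-∘ˡ : ∀ {s t : Sign} {f g h : V n → V n} → Linear f →
                  Commutes s f h → Commutes t g h → Commutes (s Sign.* t) (f ∘ g) h
    commutes-∘ˡ {s = s} {t} {f} {g} {h} F fh gh v i = begin
      f (g (h v)) i                  ≈⟨ resp F (gh v) i ⟩
      f (sgn t · h (g v)) i          ≈⟨ homo· F (sgn t) (h (g v)) i ⟩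
      sgn t * f (h (g v)) i          ≈⟨ *-congˡ (fh (g v) i) ⟩
      sgn t * (sgn s * h (f (g v)) i) ≈⟨ sgn-·-* t s (h (f (g v))) i ⟩
      sgn (t Sign.* s) * h (f (g v)) i ≡⟨ ≡.cong (λ p → sgn p * h (f (g v)) i) (Sign.*-comm t s) ⟩
      sgn (s Sign.* t) * h (f (g v)) i ∎

    commutes-∘ʳ : ∀ {s t : Sign} {f g h : V n → V n} → Linear g →
                  Commutes s f g → Commutes t f h → Commutes (s Sign.* t) f (g ∘ h)
    commutes-∘ʳ {s = s} {t} {f} {g} {h} G fg fh v i = begin
      f (g (h v)) i                   ≈⟨ fg (h v) i ⟩
      sgn s * g (f (h v)) i           ≈⟨ *-congˡ (resp G (fh v) i) ⟩
      sgn s * g (sgn t · h (f v)) i   ≈⟨ *-congˡ (homo· G (sgn t) (h (f v)) i) ⟩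
      sgn s * (sgn t * g (h (f v)) i) ≈⟨ sgn-·-* s t (g (h (f v))) i ⟩
      sgn (s Sign.* t) * g (h (f v)) i ∎

    -- `anticommute` is the Hurwitz equation Uᵢᵀ Uₖ + Uₖᵀ Uᵢ = 0, stated through inner products.
    module Clifford {r n} (U : Fin r → V n → V n) (U-isometry : ∀ i → Isometry (U i))
      (anticommute : ∀ {i k} → i ≢ k → ∀ u v → ⟨ U i u , U k v ⟩ + ⟨ U k u , U i v ⟩ ≈ 0#) where

      U-linear : ∀ i → Linear (U i)
      U-linear i = Isometry.linear (U-isometry i)

      private
        T : Fin r → V n → V n
        T i = transpose (U i)

        T-linear : ∀ i → Linear (T i)
        T-linear i = transpose-linear (U i)

        T-U : ∀ i v → T i (U i v) ≋ v
        T-U i = transpose-inverseˡ (U-isometry i)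

        U-T : ∀ i v → U i (T i v) ≋ v
        U-T i = transpose-inverseʳ (U-isometry i)

        ε : Fin r → Fin r → Sign
        ε i k = Sign.opposite (σ i k)

        +≈0⇒ : ∀ {x y} → x + y ≈ 0# → x ≈ - 1# * y
        +≈0⇒ {x} {y} x+y≈0 = trans (+-cancelʳ y _ _ (trans x+y≈0 (sym (-‿inverseˡ y)))) (sym (-1*x≈-x y))

        TU-swap : ∀ i k v → T i (U k v) ≋ sgn (ε i k) · T k (U i v)
        TU-swap i k v j with i Fin.≟ k
        ... | yes ≡.refl = sym (*-identityˡ _)
        ... | no  i≢k    = +≈0⇒ (anticommute i≢k (e j) v)

        -- The companion of `TU-swap` with the transpose on the right. It fails for isometries into
        -- a larger space: the proof inserts Uᵢ Uᵢᵀ = 1, the gain from squareness.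
        UT-swap : ∀ i k v → U i (T k v) ≋ sgn (ε i k) · U k (T i v)
        UT-swap i k v j with i Fin.≟ k | TU-swap k i (T i v)
        ... | yes ≡.refl | _ = sym (*-identityˡ _)
        ... | no  i≢k | swap rewrite dec-false (k Fin.≟ i) (i≢k ∘ ≡.sym) = begin
          U i (T k v) j                          ≈⟨ resp (U-linear i) (resp (T-linear k) (U-T i v)) j ⟨
          U i (T k (U i (T i v))) j              ≈⟨ resp (U-linear i) swap j ⟩
          U i (- 1# · T i (U k (T i v))) j       ≈⟨ homo· (U-linear i) (- 1#) _ j ⟩
          - 1# * U i (T i (U k (T i v))) j       ≈⟨ *-congˡ (U-T i (U k (T i v)) j) ⟩
          - 1# * U k (T i v) j                   ∎

      G : Fin r → Fin r → V n → V n
      G i k v = T i (U k v)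

      G-linear : ∀ i k → Linear (G i k)
      G-linear i k = ∘-linear (T-linear i) (U-linear k)

      G-inverse : ∀ i k v → G i k (G k i v) ≋ v
      G-inverse i k v j = trans (resp (T-linear i) (U-T k (U i v)) j) (T-U i v j)

      G-∼ : ∀ {i k u v} → U i u ∼ U k v → u ∼ G i k v
      G-∼ {i} {k} {u} {v} Uu∼Uv =
        ∼-trans (∼-sym (≋⇒∼ (T-U i u))) (linear-∼ (T-linear i) Uu∼Uv)

      -- Four swaps, one for each index on the left with each on the right. A swap of different
      -- indices costs a minus sign; comparing with `σ`, which is minus on equal indices, the four
      -- extra signs cancel.
      commutes-G : ∀ i k p q → Commutes (parity (i ∷ k ∷ []) (p ∷ q ∷ [])) (G i k) (G p q)
      commutes-G i k p q v j = begin
        T i (U k (T p (U q v))) j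
          ≈⟨ resp (T-linear i) (UT-swap k p (U q v)) j ⟩
        T i (sgn (ε k p) · U p (T k (U q v))) j
          ≈⟨ homo· (T-linear i) (sgn (ε k p)) _ j ⟩
        sgn (ε k p) * T i (U p (T k (U q v))) j
          ≈⟨ *-congˡ (TU-swap i p (T k (U q v)) j) ⟩
        sgn (ε k p) * (sgn (ε i p) * T p (U i (T k (U q v))) j)
          ≈⟨ *-congˡ (*-congˡ (inner j)) ⟩
        sgn (ε k p) * (sgn (ε i p) * (sgn (ε k q) * (sgn (ε i q) * T p (U q (T i (U k v))) j)))
          ≈⟨ *-congˡ (*-congˡ (sgn-·-* (ε k q) (ε i q) w j)) ⟩
        sgn (ε k p) * (sgn (ε i p) * (sgn (ε k q Sign.* ε i q) * T p (U q (T i (U k v))) j))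
          ≈⟨ *-congˡ (sgn-·-* (ε i p) (ε k q Sign.* ε i q) w j) ⟩
        sgn (ε k p) * (sgn (ε i p Sign.* (ε k q Sign.* ε i q)) * T p (U q (T i (U k v))) j)
          ≈⟨ sgn-·-* (ε k p) (ε i p Sign.* (ε k q Sign.* ε i q)) w j ⟩
        sgn (ε k p Sign.* (ε i p Sign.* (ε k q Sign.* ε i q))) * T p (U q (T i (U k v))) j
          ≡⟨ ≡.cong (λ s → sgn s * T p (U q (T i (U k v))) j) (signs (σ i p) (σ i q) (σ k p) (σ k q)) ⟩
        sgn (parity (i ∷ k ∷ []) (p ∷ q ∷ [])) * T p (U q (T i (U k v))) j ∎
        where
        w : V n
        w = T p (U q (T i (U k v)))
        inner : T p (U i (T k (U q v))) ≋ sgn (ε k q) · sgn (ε i q) · T p (U q (T i (U k v)))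
        inner j = begin
          T p (U i (T k (U q v))) j
            ≈⟨ resp (T-linear p) (resp (U-linear i) (TU-swap k q v)) j ⟩
          T p (U i (sgn (ε k q) · T q (U k v))) j
            ≈⟨ homo· (∘-linear (T-linear p) (U-linear i)) (sgn (ε k q)) _ j ⟩
          sgn (ε k q) * T p (U i (T q (U k v))) j
            ≈⟨ *-congˡ (resp (T-linear p) (UT-swap i q (U k v)) j) ⟩
          sgn (ε k q) * T p (sgn (ε i q) · U q (T i (U k v))) j
            ≈⟨ *-congˡ (homo· (T-linear p) (sgn (ε i q)) _ j) ⟩
          sgn (ε k q) * (sgn (ε i q) * T p (U q (T i (U k v))) j) ∎
        opposite = Sign.opposite
        signs : ∀ a b c d →
          opposite c Sign.* (opposite a Sign.* (opposite d Sign.* opposite b)) ≡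
          (a Sign.* (b Sign.* Sign.+)) Sign.* ((c Sign.* (d Sign.* Sign.+)) Sign.* Sign.+)
        signs Sign.+ Sign.+ Sign.+ Sign.+ = ≡.refl
        signs Sign.+ Sign.+ Sign.+ Sign.- = ≡.refl
        signs Sign.+ Sign.+ Sign.- Sign.+ = ≡.refl
        signs Sign.+ Sign.+ Sign.- Sign.- = ≡.refl
        signs Sign.+ Sign.- Sign.+ Sign.+ = ≡.refl
        signs Sign.+ Sign.- Sign.+ Sign.- = ≡.refl
        signs Sign.+ Sign.- Sign.- Sign.+ = ≡.refl
        signs Sign.+ Sign.- Sign.- Sign.- = ≡.refl
        signs Sign.- Sign.+ Sign.+ Sign.+ = ≡.refl
        signs Sign.- Sign.+ Sign.+ Sign.- = ≡.refl
        signs Sign.- Sign.+ Sign.- Sign.+ = ≡.refl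
        signs Sign.- Sign.+ Sign.- Sign.- = ≡.refl
        signs Sign.- Sign.- Sign.+ Sign.+ = ≡.refl
        signs Sign.- Sign.- Sign.+ Sign.- = ≡.refl
        signs Sign.- Sign.- Sign.- Sign.+ = ≡.refl
        signs Sign.- Sign.- Sign.- Sign.- = ≡.refl

      W : (i k p q : Fin r) → V n → V n
      W i k p q = G i k ∘ G p q

      W-linear : ∀ i k p q → Linear (W i k p q)
      W-linear i k p q = ∘-linear (G-linear i k) (G-linear p q)

      commutes-WG : ∀ i k p q a b → Commutes (parity (i ∷ k ∷ p ∷ q ∷ []) (a ∷ b ∷ [])) (W i k p q) (G a b)
      commutes-WG i k p q a b = ≡.subst (λ s → Commutes s (W i k p q) (G a b))
        (≡.sym (parity-++ˡ (i ∷ k ∷ []) (p ∷ q ∷ []) (a ∷ b ∷ [])))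
        (commutes-∘ˡ {s = parity (i ∷ k ∷ []) (a ∷ b ∷ [])} {t = parity (p ∷ q ∷ []) (a ∷ b ∷ [])}
          (G-linear i k) (commutes-G i k a b) (commutes-G p q a b))

      commutes-WW : ∀ i k p q a b c d →
        Commutes (parity (i ∷ k ∷ p ∷ q ∷ []) (a ∷ b ∷ c ∷ d ∷ [])) (W i k p q) (W a b c d)
      commutes-WW i k p q a b c d = ≡.subst (λ s → Commutes s (W i k p q) (W a b c d))
        (≡.sym (parity-++ʳ (i ∷ k ∷ p ∷ q ∷ []) (a ∷ b ∷ []) (c ∷ d ∷ [])))
        (commutes-∘ʳ {s = parity (i ∷ k ∷ p ∷ q ∷ []) (a ∷ b ∷ [])} {t = parity (i ∷ k ∷ p ∷ q ∷ []) (c ∷ d ∷ [])}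
          (G-linear a b) (commutes-WG i k p q a b) (commutes-WG i k p q c d))

      -- `W` and `G a b` commute up to sign and `G a b` is invertible, so being fixed up to sign
      -- passes from `G a b u` back to `u`. This gives relations from different columns a common
      -- eigenvector.
      W-transport : ∀ i k p q {a b u v} → v ∼ G a b u → W i k p q v ∼ v → W i k p q u ∼ u
      W-transport i k p q {a} {b} {u} {v} v∼Gu Wv∼v =
        ∼-trans (∼-sym (≋⇒∼ (G-inverse b a (W i k p q u))))
       (∼-trans (linear-∼ (G-linear b a) GWu∼Gu)
                (≋⇒∼ (G-inverse b a u)))
        where
        GWu∼Gu : G a b (W i k p q u) ∼ G a b u
        GWu∼Gu = ∼-trans (∼-sym (parity (i ∷ k ∷ p ∷ q ∷ []) (a ∷ b ∷ []) , commutes-WG i k p q a b u))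
                (∼-trans (linear-∼ (W-linear i k p q) (∼-sym v∼Gu))
                (∼-trans Wv∼v v∼Gu))

      W-even : ¬ 1# ≈ 0# → ∀ {i k p q a b c d u} → ⟨ u , u ⟩ ≈ 1# →
               W i k p q u ∼ u → W a b c d u ∼ u → parity (i ∷ k ∷ p ∷ q ∷ []) (a ∷ b ∷ c ∷ d ∷ []) ≡ Sign.+
      W-even 1≉0 {i} {k} {p} {q} {a} {b} {c} {d} {u} ∣u∣²≈1 (s , Wu≋su) (t , W′u≋tu) =
        go _ (commutes-WW i k p q a b c d u)
        where
        WW′u : W i k p q (W a b c d u) ≋ sgn (s Sign.* t) · u
        WW′u j = begin
          W i k p q (W a b c d u) j      ≈⟨ resp (W-linear i k p q) W′u≋tu j ⟩
          W i k p q (sgn t · u) j        ≈⟨ homo· (W-linear i k p q) (sgn t) u j ⟩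
          sgn t * W i k p q u j          ≈⟨ *-congˡ (Wu≋su j) ⟩
          sgn t * (sgn s * u j)          ≈⟨ sgn-·-* t s u j ⟩
          sgn (t Sign.* s) * u j         ≡⟨ ≡.cong (λ x → sgn x * u j) (Sign.*-comm t s) ⟩
          sgn (s Sign.* t) * u j         ∎
        W′Wu : W a b c d (W i k p q u) ≋ sgn (s Sign.* t) · u
        W′Wu j = begin
          W a b c d (W i k p q u) j      ≈⟨ resp (W-linear a b c d) Wu≋su j ⟩
          W a b c d (sgn s · u) j        ≈⟨ homo· (W-linear a b c d) (sgn s) u j ⟩
          sgn s * W a b c d u j          ≈⟨ *-congˡ (W′u≋tu j) ⟩
          sgn s * (sgn t * u j)          ≈⟨ sgn-·-* s t u j ⟩
          sgn (s Sign.* t) * u j         ∎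
        go : ∀ x → W i k p q (W a b c d u) ≋ sgn x · W a b c d (W i k p q u) → x ≡ Sign.+
        go Sign.+ _  = ≡.refl
        go Sign.- eq = contradiction (trans (sym ∣u∣²≈1) ∣u∣²≈0) 1≉0
          where
          st·u≋0 : sgn (s Sign.* t) · u ≋ λ _ → 0#
          st·u≋0 j = double-injective (begin
            sgn (s Sign.* t) * u j + sgn (s Sign.* t) * u j
              ≈⟨ +-cong (trans (sym (WW′u j)) (eq j)) (sym (W′Wu j)) ⟩
            - 1# * W a b c d (W i k p q u) j + W a b c d (W i k p q u) j
              ≈⟨ trans (+-congʳ (-1*x≈-x _)) (-‿inverseˡ _) ⟩
            0#
              ≈⟨ +-identityˡ 0# ⟨
            0# + 0# ∎)
          ∣u∣²≈0 : ⟨ u , u ⟩ ≈ 0#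
          ∣u∣²≈0 = begin
            ⟨ u , u ⟩
              ≈⟨ ⟨⟩-cong (proj₂ (∼-sym {u = sgn (s Sign.* t) · u} (s Sign.* t , λ _ → refl))) (λ _ → refl) ⟩
            ⟨ sgn (s Sign.* t) · sgn (s Sign.* t) · u , u ⟩
              ≈⟨ ⟨⟩-cong {v = u} (λ j → trans (*-congˡ (st·u≋0 j)) (trans (zeroʳ _) (sym (zeroˡ (u j))))) (λ _ → refl) ⟩
            ⟨ 0# · u , u ⟩
              ≈⟨ trans (⟨⟩-·ˡ 0# u u) (zeroˡ _) ⟩
            0# ∎

      module Coloured (1≉0 : ¬ 1# ≈ 0#)
        {s t} (y : Fin s → V n) (z : Fin t → V n)
        (y-orthonormal : ∀ j l → ⟨ y j , y l ⟩ ≈ e j l)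
        (z-orthonormal : ∀ a b → ⟨ z a , z b ⟩ ≈ e a b)
        (c : Fin r → Fin s → Fin t)
        (colour : ∀ i j → U i (y j) ∼ z (c i j)) where

        private
          same : ∀ {a u v} → u ∼ z a → v ∼ z a → ¬ ⟨ u , v ⟩ ≈ 0#
          same {a} {u} {v} (s , u≋) (t , v≋) uv≈0 = ±1≉0 (s Sign.* t) (begin
            sgn (s Sign.* t)                   ≈⟨ *-identityʳ _ ⟨
            sgn (s Sign.* t) * 1#              ≈⟨ *-cong (sgn-* s t) (sym (trans (z-orthonormal a a) (e-≡ a))) ⟩
            (sgn s * sgn t) * ⟨ z a , z a ⟩    ≈⟨ *-assoc _ _ _ ⟩
            sgn s * (sgn t * ⟨ z a , z a ⟩)    ≈⟨ *-congˡ (⟨⟩-·ʳ (sgn t) (z a) (z a)) ⟨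
            sgn s * ⟨ z a , sgn t · z a ⟩      ≈⟨ ⟨⟩-·ˡ (sgn s) (z a) (sgn t · z a) ⟨
            ⟨ sgn s · z a , sgn t · z a ⟩      ≈⟨ ⟨⟩-cong u≋ v≋ ⟨
            ⟨ u , v ⟩                          ≈⟨ uv≈0 ⟩
            0#                                 ∎)
            where
            ±1≉0 : ∀ x → ¬ sgn x ≈ 0#
            ±1≉0 Sign.+ 1≈0  = 1≉0 1≈0
            ±1≉0 Sign.- -1≈0 = 1≉0 (begin
              1#             ≈⟨ +-identityʳ 1# ⟨
              1# + 0#        ≈⟨ +-congˡ -1≈0 ⟨
              1# + - 1#      ≈⟨ -‿inverseʳ 1# ⟩
              0#             ∎)

          distinct : ∀ {a b u v} → a ≢ b → u ∼ z a → v ∼ z b → ⟨ u , v ⟩ ≈ 0#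
          distinct {a} {b} {u} {v} a≢b (s , u≋) (t , v≋) = begin
            ⟨ u , v ⟩                          ≈⟨ ⟨⟩-cong u≋ v≋ ⟩
            ⟨ sgn s · z a , sgn t · z b ⟩      ≈⟨ ⟨⟩-·ˡ (sgn s) (z a) (sgn t · z b) ⟩
            sgn s * ⟨ z a , sgn t · z b ⟩      ≈⟨ *-congˡ (⟨⟩-·ʳ (sgn t) (z a) (z b)) ⟩
            sgn s * (sgn t * ⟨ z a , z b ⟩)    ≈⟨ *-congˡ (*-congˡ (trans (z-orthonormal a b) (e-≢ a≢b))) ⟩
            sgn s * (sgn t * 0#)               ≈⟨ trans (*-congˡ (zeroʳ _)) (zeroʳ _) ⟩
            0#                                 ∎

          shared-colour : ∀ {i j k l} → c i j ≡ c k l → U k (y l) ∼ z (c i j)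
          shared-colour {k = k} {l} eq = ≡.subst (λ a → U k (y l) ∼ z a) (≡.sym eq) (colour k l)

        row-injective : ∀ i {j l} → c i j ≡ c i l → j ≡ l
        row-injective i {j} {l} eq with j Fin.≟ l
        ... | yes j≡l = j≡l
        ... | no  j≢l = contradiction
          (trans (Isometry.preserves (U-isometry i) (y j) (y l)) (trans (y-orthonormal j l) (e-≢ j≢l)))
          (same (colour i j) (shared-colour eq))

        column-injective : ∀ j {i k} → c i j ≡ c k j → i ≡ k
        column-injective j {i} {k} eq with i Fin.≟ k
        ... | yes i≡k = i≡k
        ... | no  i≢k = contradiction
          (double-injective (begin
            ⟨ U i (y j) , U k (y j) ⟩ + ⟨ U i (y j) , U k (y j) ⟩
              ≈⟨ +-congˡ (⟨⟩-sym (U i (y j)) (U k (y j))) ⟩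
            ⟨ U i (y j) , U k (y j) ⟩ + ⟨ U k (y j) , U i (y j) ⟩
              ≈⟨ anticommute i≢k (y j) (y j) ⟩
            0#
              ≈⟨ +-identityˡ 0# ⟨
            0# + 0# ∎))
          (same (colour i j) (shared-colour eq))

        -- Equal colours make the first inner product in `anticommute` nonzero, so the second cannot
        -- vanish, as it would if the opposite corners had distinct, hence orthogonal, colours.
        intercalate : ∀ {i j k l} → c i j ≡ c k l → c k j ≡ c i l
        intercalate {i} {j} {k} {l} eq with i Fin.≟ k | c k j Fin.≟ c i l
        ... | yes ≡.refl | _ = eq
        ... | no _    | yes eq′ = eq′
        ... | no i≢k  | no kj≢il = contradiction
          (begin
            ⟨ U i (y j) , U k (y l) ⟩
              ≈⟨ +-identityʳ _ ⟨
            ⟨ U i (y j) , U k (y l) ⟩ + 0#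
              ≈⟨ +-congˡ (distinct kj≢il (colour k j) (colour i l)) ⟨
            ⟨ U i (y j) , U k (y l) ⟩ + ⟨ U k (y j) , U i (y l) ⟩
              ≈⟨ anticommute i≢k (y j) (y l) ⟩
            0# ∎)
          (same (colour i j) (shared-colour eq))

        private
          link : ∀ {i j k l} → c i j ≡ c k l → y j ∼ G i k (y l)
          link {i} {j} eq = G-∼ (∼-trans (colour i j) (∼-sym (shared-colour eq)))

        -- By `intercalate`, `G p q` takes `y j` to ± `y l`, and `G i k` takes that back to ± `y j`.
        -- The colour shared by columns `j₀` and `j` then moves this to `y j₀`.
        relation-fixes : ∀ {i k p q j l j₀ a b} → c i j ≡ c k l → c p j ≡ c q l → c a j₀ ≡ c b j →
                         W i k p q (y j₀) ∼ y j₀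
        relation-fixes {i} {k} {p} {q} eq eq′ eq₀ = W-transport i k p q (link (≡.sym eq₀))
          (∼-sym (∼-trans (link eq) (linear-∼ (G-linear i k) (link (≡.sym (intercalate eq′))))))

        relation-even : ∀ j₀ → (∀ j → ∃[ a ] ∃[ b ] c a j₀ ≡ c b j) →
                        ∀ {xs ys} → Relation c xs → Relation c ys → parity xs ys ≡ Sign.+
        relation-even j₀ linked (relation {j = j} m₁ m₂) (relation {j = j′} m₃ m₄) =
          W-even 1≉0 (trans (y-orthonormal j₀ j₀) (e-≡ j₀))
            (relation-fixes m₁ m₂ (proj₂ (proj₂ (linked j))))
            (relation-fixes m₃ m₄ (proj₂ (proj₂ (linked j′))))

    module _ {h m n} {F : V h → V m → V n} (linearˡ : ∀ y → Linear (λ x → F x y))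
             (linearʳ : ∀ x → Linear (F x)) (normed : ∀ x y → ⟨ F x y , F x y ⟩ ≈ ⟨ x , x ⟩ * ⟨ y , y ⟩) where

      unit-isometry : ∀ {x} → ⟨ x , x ⟩ ≈ 1# → Isometry (F x)
      unit-isometry {x} ∣x∣²≈1 = isometry (linearʳ x) λ v →
        trans (normed x v) (trans (*-congʳ ∣x∣²≈1) (*-identityˡ _))

      -- Compare the polarised norm identity at `x ⊕ x′` with those at `x` and `x′`: by
      -- orthogonality the squared norms add, so the cross terms cancel.
      orthogonal-anticommute : ∀ {x x′} → ⟨ x , x′ ⟩ ≈ 0# →
                               ∀ u v → ⟨ F x u , F x′ v ⟩ + ⟨ F x′ u , F x v ⟩ ≈ 0#
      orthogonal-anticommute {x} {x′} x⊥x′ u v = +-cancelˡ (a + b) _ _ (begin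
        (a + b) + (⟨ F x u , F x′ v ⟩ + ⟨ F x′ u , F x v ⟩)
          ≈⟨ solve 4 (λ a b c d → (a :+ b) :+ (c :+ d) := (a :+ c) :+ (d :+ b)) refl a b _ _ ⟩
        (a + ⟨ F x u , F x′ v ⟩) + (⟨ F x′ u , F x v ⟩ + b)
          ≈⟨ trans (⟨⟩-⊕ˡ (F x u) (F x′ u) (F x v ⊕ F x′ v))
                   (+-cong (⟨⟩-⊕ʳ (F x u) (F x v) (F x′ v)) (⟨⟩-⊕ʳ (F x′ u) (F x v) (F x′ v))) ⟨
        ⟨ F x u ⊕ F x′ u , F x v ⊕ F x′ v ⟩
          ≈⟨ ⟨⟩-cong (homo⊕ (linearˡ u) x x′) (homo⊕ (linearˡ v) x x′) ⟨
        ⟨ F (x ⊕ x′) u , F (x ⊕ x′) v ⟩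
          ≈⟨ polar (x ⊕ x′) ⟩
        ⟨ x ⊕ x′ , x ⊕ x′ ⟩ * ⟨ u , v ⟩
          ≈⟨ *-congʳ (trans (∣⊕∣² x x′) (trans (+-congˡ (trans (+-cong x⊥x′ x⊥x′) (+-identityˡ _))) (+-identityʳ _))) ⟩
        (⟨ x , x ⟩ + ⟨ x′ , x′ ⟩) * ⟨ u , v ⟩
          ≈⟨ distribʳ _ _ _ ⟩
        ⟨ x , x ⟩ * ⟨ u , v ⟩ + ⟨ x′ , x′ ⟩ * ⟨ u , v ⟩
          ≈⟨ +-cong (polar x) (polar x′) ⟨
        a + b
          ≈⟨ +-identityʳ _ ⟨
        (a + b) + 0# ∎)
        where
        open SemiringSolver commutativeSemiring
        a b : Carrier
        a = ⟨ F x u , F x v ⟩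
        b = ⟨ F x′ u , F x′ v ⟩
        polar : ∀ x → ⟨ F x u , F x v ⟩ ≈ ⟨ x , x ⟩ * ⟨ u , v ⟩
        polar x = polarise (linearʳ x) ⟨ x , x ⟩ (normed x) u v

  coefficient : (C : Fin m → Fin n → Carrier) → ∀ i j →
                sum (λ i′ → sum λ j′ → C i′ j′ * (e i i′ * e j j′)) ≈ C i j
  coefficient C i j = begin
    sum (λ i′ → sum λ j′ → C i′ j′ * (e i i′ * e j j′))
      ≈⟨ sum-cong (λ i′ → sum-cong λ j′ →
           trans (*-comm _ _) (trans (*-assoc _ _ _) (*-congˡ (*-comm (e j j′) (C i′ j′))))) ⟩
    sum (λ i′ → sum λ j′ → e i i′ * (C i′ j′ * e j j′))
      ≈⟨ sum-cong (λ i′ → trans (sum-cong λ j′ → *-congˡ (*-comm (C i′ j′) (e j j′)))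
           (trans (sym (*-distribˡ-sum (e i i′) (e j ⊙ C i′))) (*-congˡ (⟨e,⟩ j (C i′))))) ⟩
    sum (λ i′ → e i i′ * C i′ j)
      ≈⟨ ⟨e,⟩ i (λ i′ → C i′ j) ⟩
    C i j ∎

-- Integers and sums of squares in the reals

open import Defs
open ≡ using (refl; sym; trans; cong; cong₂; subst)

module ≈-Reasoning = SetoidReasoning R.setoid

open +-*-Solver using (solve; con; _:=_; _:+_; _:*_; _:-_)

fromℚ-injective : ∀ {p q} → fromℚ p ≈ fromℚ q → p ≡ q
fromℚ-injective {p} {q} p≈q with p ℚ.≟ q
... | yes p≡q = p≡q
... | no  p≢q =
  let N , below = close p≈q ∣ p ℚ.- q ∣ (ℚ.≰⇒> λ ≤0 → 0≢∣p-q∣ (ℚ.≤-antisym (ℚ.0≤∣p∣ (p ℚ.- q)) ≤0))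
  in contradiction (below N ℕ.≤-refl) (ℚ.<-irrefl refl)
  where
  0≢∣p-q∣ : 0ℚ ≢ ∣ p ℚ.- q ∣
  0≢∣p-q∣ eq = p≢q (trans (solve 2 (λ a b → a := (a :- b) :+ b) refl p q)
    (trans (cong (ℚ._+ q) (ℚ.∣p∣≡0⇒p≡0 (p ℚ.- q) (sym eq))) (ℚ.+-identityˡ q)))

-- The normal form of `k ℚ./ 1`, which does not reduce for a variable `k` because `ℚ._/_` divides by
-- a gcd. The field value 0 encodes denominator 1.
k/1 : ℤ → ℚ
k/1 k = mkℚ k 0 (Coprimality.sym (Coprimality.1-coprimeTo ℤ.∣ k ∣))

/1≡ : ∀ k → k ℚ./ 1 ≡ k/1 k
/1≡ k = ℚ.↥p/↧p≡p (k/1 k)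

fromℤ-injective : ∀ {k l} → fromℤ k ≈ fromℤ l → k ≡ l
fromℤ-injective {k} {l} eq =
  cong ℚ.numerator (trans (sym (/1≡ k)) (trans (fromℚ-injective eq) (/1≡ l)))

fromℤ-* : ∀ k l → fromℤ k * fromℤ l ≈ fromℤ (k ℤ.* l)
fromℤ-* k l = pointwise⇒≈ λ _ → cong₂ ℚ._*_ (/1≡ k) (/1≡ l)

fromℤ-+ : ∀ k l → fromℤ k + fromℤ l ≈ fromℤ (k ℤ.+ l)
fromℤ-+ k l = pointwise⇒≈ λ _ → trans (cong₂ ℚ._+_ (/1≡ k) (/1≡ l))
  (cong (ℚ._/ 1) (cong₂ ℤ._+_ (ℤ.*-identityʳ k) (ℤ.*-identityʳ l)))

fromℤ-squares : ∀ {n} (c : Fin n → ℤ) →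
  ∑ (λ k → fromℤ (c k) * fromℤ (c k)) ≈ fromℤ (ℤ.+ ℕ∑.sum (λ k → ℤ.∣ c k ∣ ℕ.* ℤ.∣ c k ∣))
fromℤ-squares {zero}  c = R.refl
fromℤ-squares {suc n} c = begin
  fromℤ (c zero) * fromℤ (c zero) + ∑ (λ k → fromℤ (c (suc k)) * fromℤ (c (suc k)))
    ≈⟨ R.+-cong (fromℤ-* (c zero) (c zero)) (fromℤ-squares (c ∘ suc)) ⟩
  fromℤ (c zero ℤ.* c zero) + fromℤ (ℤ.+ rest)
    ≡⟨ cong (λ k → fromℤ k + fromℤ (ℤ.+ rest)) (square (c zero)) ⟩
  fromℤ (ℤ.+ first) + fromℤ (ℤ.+ rest)
    ≈⟨ fromℤ-+ (ℤ.+ first) (ℤ.+ rest) ⟩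
  fromℤ (ℤ.+ first ℤ.+ ℤ.+ rest) ∎
  where
  open ≈-Reasoning
  first rest : ℕ
  first = ℤ.∣ c zero ∣ ℕ.* ℤ.∣ c zero ∣
  rest = ℕ∑.sum λ k → ℤ.∣ c (suc k) ∣ ℕ.* ℤ.∣ c (suc k) ∣
  square : ∀ k → k ℤ.* k ≡ ℤ.+ (ℤ.∣ k ∣ ℕ.* ℤ.∣ k ∣)
  square (ℤ.+ n)    = sym (ℤ.pos-* n n)
  square -[1+ n ] = refl

1≉0 : ¬ 1ℝ ≈ 0ℝ
1≉0 eq with () ← fromℚ-injective eq

-- A condition on the representing sequence, stronger than nonnegativity of the real and not
-- invariant under `_≈_`. Sums of squares satisfy it, and estimates become termwise.
NonNegative : ℝ → Set
NonNegative x = ∀ n → 0ℚ ℚ.≤ seq x n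

∑-nonNegative : ∀ {n} (f : Vector ℝ n) → (∀ i → NonNegative (f i)) → NonNegative (∑ f)
∑-nonNegative {zero}  f f≥0 n = ℚ.≤-refl
∑-nonNegative {suc _} f f≥0 n = ℚ.+-mono-≤ (f≥0 zero n) (∑-nonNegative (f ∘ suc) (f≥0 ∘ suc) n)

+-≈0 : ∀ x y → NonNegative x → NonNegative y → x + y ≈ 0ℝ → x ≈ 0ℝ
+-≈0 x y x≥0 y≥0 x+y≈0 = mk≈ λ ε 0<ε →
  let N , below = close x+y≈0 ε 0<ε in N , λ n N≤n → ℚ.≤-<-trans (bound n) (below n N≤n)
  where
  ∣-0∣ : ∀ {p} → 0ℚ ℚ.≤ p → ∣ p ℚ.- 0ℚ ∣ ≡ p
  ∣-0∣ {p} 0≤p = trans (cong ∣_∣ (ℚ.+-identityʳ p)) (ℚ.0≤p⇒∣p∣≡p 0≤p)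
  bound : ∀ n → ∣ seq x n ℚ.- 0ℚ ∣ ℚ.≤ ∣ seq x n ℚ.+ seq y n ℚ.- 0ℚ ∣
  bound n rewrite ∣-0∣ (x≥0 n) | ∣-0∣ (ℚ.+-mono-≤ (x≥0 n) (y≥0 n)) =
    ℚ.≤-trans (ℚ.≤-reflexive (sym (ℚ.+-identityʳ _))) (ℚ.+-monoʳ-≤ (seq x n) (y≥0 n))

∑-≈0 : ∀ {n} (f : Vector ℝ n) → (∀ i → NonNegative (f i)) → ∑ f ≈ 0ℝ → ∀ i → f i ≈ 0ℝ
∑-≈0 f f≥0 ∑f≈0 zero    = +-≈0 (f zero) (∑ (f ∘ suc)) (f≥0 zero) (∑-nonNegative (f ∘ suc) (f≥0 ∘ suc)) ∑f≈0
∑-≈0 f f≥0 ∑f≈0 (suc i) = ∑-≈0 (f ∘ suc) (f≥0 ∘ suc)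
  (+-≈0 (∑ (f ∘ suc)) (f zero) (∑-nonNegative (f ∘ suc) (f≥0 ∘ suc)) (f≥0 zero)
        (R.trans (R.+-comm (∑ (f ∘ suc)) (f zero)) ∑f≈0)) i

square-nonNegative : ∀ x → NonNegative (x * x)
square-nonNegative x n = go (ℚ.≤-total 0ℚ p)
  where
  p = seq x n
  go : 0ℚ ℚ.≤ p ⊎ p ℚ.≤ 0ℚ → 0ℚ ℚ.≤ p ℚ.* p
  go (inj₁ 0≤p) = ℚ.nonNegative⁻¹ (p ℚ.* p) {{ℚ.nonNeg*nonNeg⇒nonNeg p {{ℚ.nonNegative 0≤p}} p {{ℚ.nonNegative 0≤p}}}}
  go (inj₂ p≤0) = ℚ.nonNegative⁻¹ (p ℚ.* p) {{ℚ.nonPos*nonPos⇒nonPos p {{ℚ.nonPositive p≤0}} p {{ℚ.nonPositive p≤0}}}}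

square≈0 : ∀ x → x * x ≈ 0ℝ → x ≈ 0ℝ
square≈0 x x²≈0 = mk≈ λ ε 0<ε →
  let instance ε-pos = ℚ.positive 0<ε
      N , below = close x²≈0 (ε ℚ.* ε) (ℚ.positive⁻¹ _ {{ℚ.pos*pos⇒pos ε ε}})
  in N , λ n N≤n → ℚ.≰⇒> λ ε≤∣x∣ → ℚ.<-irrefl refl (ℚ.≤-<-trans (bound n ε≤∣x∣) (below n N≤n))
  where
  bound : ∀ {ε} {{_ : ℚ.Positive ε}} n → ε ℚ.≤ ∣ seq x n ℚ.- 0ℚ ∣ →
          ε ℚ.* ε ℚ.≤ ∣ seq x n ℚ.* seq x n ℚ.- 0ℚ ∣
  bound {ε} n ε≤ = begin
    ε ℚ.* ε                    ≤⟨ ℚ.*-monoʳ-≤-nonNeg ε {{ℚ.pos⇒nonNeg ε}} ε≤ ⟩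
    ∣ p ℚ.- 0ℚ ∣ ℚ.* ε         ≤⟨ ℚ.*-monoˡ-≤-nonNeg ∣ p ℚ.- 0ℚ ∣ {{ℚ.∣-∣-nonNeg (p ℚ.- 0ℚ)}} ε≤ ⟩
    ∣ p ℚ.- 0ℚ ∣ ℚ.* ∣ p ℚ.- 0ℚ ∣ ≡⟨ ℚ.∣p*q∣≡∣p∣*∣q∣ (p ℚ.- 0ℚ) (p ℚ.- 0ℚ) ⟨
    ∣ (p ℚ.- 0ℚ) ℚ.* (p ℚ.- 0ℚ) ∣ ≡⟨ cong ∣_∣ (solve 1 (λ p → (p :- con 0ℚ) :* (p :- con 0ℚ) := p :* p :- con 0ℚ) refl p) ⟩
    ∣ p ℚ.* p ℚ.- 0ℚ ∣         ∎
    where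
    open ℚ.≤-Reasoning
    p = seq x n

∑∑-squares≈0 : ∀ {m n} (M : Fin m → Fin n → ℝ) →
               ∑ (λ a → ∑ (λ b → M a b * M a b)) ≈ 0ℝ → ∀ a b → M a b ≈ 0ℝ
∑∑-squares≈0 M eq a b = square≈0 (M a b)
  (∑-≈0 (λ b → M a b * M a b) (λ b → square-nonNegative (M a b))
    (∑-≈0 (λ a → ∑ (λ b → M a b * M a b))
      (λ a → ∑-nonNegative (λ b → M a b * M a b) (λ b → square-nonNegative (M a b))) eq a) b)

module E = EuclideanSpace ℝ-commutativeRing
open E using (e; _∼_; Linear; ⟨_,_⟩)

double-injective : ∀ {x y} → x + x ≈ y + y → x ≈ y
double-injective {x} {y} eq = begin
  x                  ≈⟨ halves x ⟩
  fromℚ ½ * (x + x)  ≈⟨ R.*-congˡ {fromℚ ½} {x + x} {y + y} eq ⟩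
  fromℚ ½ * (y + y)  ≈⟨ halves y ⟨
  y                  ∎
  where
  open ≈-Reasoning
  halves : ∀ x → x ≈ fromℚ ½ * (x + x)
  halves x = pointwise⇒≈ λ n → solve 1 (λ x → x := con ½ :* (x :+ x)) refl (seq x n)

open E.Orthogonality double-injective ∑∑-squares≈0

fromIsLinear : ∀ {m n} {f : Vector ℝ m → Vector ℝ n} → IsLinear f → Linear f
fromIsLinear {m} {n} lin = record
  { resp  = ⟦⟧-cong
  ; homo⊕ = +ᴹ-homo
  ; homo· = *ₗ-homo
  }
  where
  open LeftModuleMorphisms (LeftModule.rawLeftModule (ℝ^ m)) (LeftModule.rawLeftModule (ℝ^ n))
  open IsLeftModuleHomomorphism lin

onto-isometry : ∀ {d n} {X : Pred (Vector ℝ n) 0ℓ} {φ : Vector ℝ d → Vector ℝ n} →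
                IsLinearIsometryOnto X φ → Isometry φ
onto-isometry iso = isometry (fromIsLinear isLinear) (IsLinearIsometryOnto.isometry iso)
  where open IsLinearIsometryOnto iso using (isLinear)

-- Integral formulas as signed colourings

Σ≡1⇒unique : ∀ {n} (f : Fin n → ℕ) → ℕ∑.sum f ≡ 1 → ∃[ k ] f k ≡ 1 × ∀ l → k ≢ l → f l ≡ 0
Σ≡1⇒unique {suc n} f eq with f zero in f₀
... | zero =
  let k , fk≡1 , others = Σ≡1⇒unique (f ∘ suc) eq
  in suc k , fk≡1 , λ { zero _ → f₀ ; (suc l) k≢l → others l (k≢l ∘ cong suc) }
... | suc zero = zero , f₀ , λ
  { zero 0≢0 → contradiction refl 0≢0
  ; (suc l) _ → ℕ.n≤0⇒n≡0 (ℕ.≤-trans (term≤Σ (f ∘ suc) l) (ℕ.≤-reflexive (ℕ.suc-injective eq))) }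
  where
  term≤Σ : ∀ {n} (f : Fin n → ℕ) l → f l ℕ.≤ ℕ∑.sum f
  term≤Σ f zero    = ℕ.m≤m+n (f zero) _
  term≤Σ f (suc l) = ℕ.≤-trans (term≤Σ (f ∘ suc) l) (ℕ.m≤n+m _ (f zero))

∣k∣²≡1⇒±1 : ∀ k → ℤ.∣ k ∣ ℕ.* ℤ.∣ k ∣ ≡ 1 → ∃[ s ] fromℤ k ≈ E.sgn s
∣k∣²≡1⇒±1 k eq with k | ℕ.m*n≡1⇒m≡1 ℤ.∣ k ∣ ℤ.∣ k ∣ eq
... | ℤ.+ _     | refl = Sign.+ , R.refl
... | -[1+ _ ]  | refl = Sign.- , pointwise⇒≈ λ _ → refl

-- The squares are natural numbers with sum 1, so exactly one entry is ±1 and the rest vanish. The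
-- index of that entry becomes the colour.
integer-unit-vector : ∀ {n} (k : Fin n → ℤ) → ∑ (λ a → fromℤ (k a) * fromℤ (k a)) ≈ 1ℝ →
                      ∃[ a ] (λ b → fromℤ (k b)) ∼ e a
integer-unit-vector k unit =
  let a , ka≡1 , others = Σ≡1⇒unique square Σ≡1
      s , ka≈s          = ∣k∣²≡1⇒±1 (k a) ka≡1
  in a , s , entry a s ka≈s others
  where
  square : Fin _ → ℕ
  square a = ℤ.∣ k a ∣ ℕ.* ℤ.∣ k a ∣

  Σ≡1 : ℕ∑.sum square ≡ 1
  Σ≡1 = ℤ.+-injective (fromℤ-injective {ℤ.+ ℕ∑.sum square} {ℤ.+ 1} (R.trans (R.sym (fromℤ-squares k)) unit))

  entry : ∀ a s → fromℤ (k a) ≈ E.sgn s → (∀ b → a ≢ b → square b ≡ 0) →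
          ∀ b → fromℤ (k b) ≈ E.sgn s * e a b
  entry a s ka≈s others b = go (a Fin.≟ b)
    where
    open ≈-Reasoning
    go : Dec (a ≡ b) → fromℤ (k b) ≈ E.sgn s * e a b
    go (yes refl) = begin
      fromℤ (k a)        ≈⟨ ka≈s ⟩
      E.sgn s            ≈⟨ R.*-identityʳ (E.sgn s) ⟨
      E.sgn s * 1ℝ       ≈⟨ R.*-congˡ {E.sgn s} {e a a} {1ℝ} (E.e-≡ a) ⟨
      E.sgn s * e a a    ∎
    go (no a≢b) = begin
      fromℤ (k b)        ≡⟨ cong fromℤ (ℤ.∣i∣≡0⇒i≡0 {k b} ([ id , id ]′ (ℕ.m*n≡0⇒m≡0∨n≡0 ℤ.∣ k b ∣ (others b a≢b)))) ⟩
      0ℝ                 ≈⟨ R.zeroʳ (E.sgn s) ⟨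
      E.sgn s * 0ℝ       ≈⟨ R.*-congˡ {E.sgn s} {e a b} {0ℝ} (E.e-≢ a≢b) ⟨
      E.sgn s * e a b    ∎

integral-colour : ∀ {r s n} (g : NormedBilinearMap r s n) → IsIntegral g →
                  ∀ i j → ∃[ k ] map g (e i) (e j) ∼ e k
integral-colour g (c , expand) i j =
  let k , coefficients∼ = integer-unit-vector (λ k → c k i j) unit
  in k , E.∼-trans {w = e k} (E.≋⇒∼ entry) coefficients∼
  where
  open ≈-Reasoning
  entry : ∀ k → map g (e i) (e j) k ≈ fromℤ (c k i j)
  entry k = R.trans (expand k (e i) (e j)) (E.coefficient (λ i j → fromℤ (c k i j)) i j)
  unit : ∑ (λ k → fromℤ (c k i j) * fromℤ (c k i j)) ≈ 1ℝ
  unit = begin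
    ∑ (λ k → fromℤ (c k i j) * fromℤ (c k i j))  ≈⟨ E.⟨⟩-cong entry entry ⟨
    ∣ map g (e i) (e j) ∣²                        ≈⟨ NormedBilinearMap.normed g (e i) (e j) ⟩
    ⟨ e i , e i ⟩ * ⟨ e j , e j ⟩                 ≈⟨ R.*-cong (E.⟨e,e⟩-≡ i) (E.⟨e,e⟩-≡ j) ⟩
    1ℝ * 1ℝ                                       ≈⟨ R.*-identityˡ 1ℝ ⟩
    1ℝ                                            ∎

-- From a restriction to a forbidden matrix

module _ {h m} (F : NormedBilinearMap h m m) {g : NormedBilinearMap 10 10 16}
  (restriction : IsRestriction g F)
  (c : Fin 10 → Fin 10 → Fin 16) (coloured : ∀ i j → map g (e i) (e j) ∼ e (c i j)) where

  open IsRestriction restriction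

  private
    α′ : Isometry α
    α′ = onto-isometry α-isometry

    β′ : Isometry β
    β′ = onto-isometry β-isometry

    γ′ : Isometry γ
    γ′ = onto-isometry γ-isometry

    orthonormal : ∀ {d n} {φ : Vector ℝ d → Vector ℝ n} → Isometry φ →
                  ∀ a b → ⟨ φ (e a) , φ (e b) ⟩ ≈ e a b
    orthonormal φ a b = R.trans (Isometry.preserves φ (e a) (e b))
      (R.trans (E.⟨⟩-sym (e a) (e b)) (E.⟨e,⟩ b (e a)))

    U : Fin 10 → Vector ℝ m → Vector ℝ m
    U i = map F (α (e i))

    linearˡ : ∀ y → Linear (λ x → map F x y)
    linearˡ y = fromIsLinear (NormedBilinearMap.linearˡ F y)

    linearʳ : ∀ x → Linear (map F x)
    linearʳ x = fromIsLinear (NormedBilinearMap.linearʳ F x)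

    U-isometry : ∀ i → Isometry (U i)
    U-isometry i = unit-isometry linearˡ linearʳ (NormedBilinearMap.normed F)
      (R.trans (orthonormal α′ i i) (E.e-≡ i))

    anticommute : ∀ {i k} → i ≢ k → ∀ u v → ⟨ U i u , U k v ⟩ + ⟨ U k u , U i v ⟩ ≈ 0ℝ
    anticommute {i} {k} i≢k = orthogonal-anticommute linearˡ linearʳ (NormedBilinearMap.normed F)
      (R.trans (orthonormal α′ i k) (E.e-≢ i≢k))

    U-y : ∀ i j → U i (β (e j)) ∼ γ (e (c i j))
    U-y i j = E.∼-trans {u = U i (β (e j))} {v = γ (map g (e i) (e j))} {w = γ (e (c i j))}
      (E.∼-sym (E.≋⇒∼ (commutes (e i) (e j))))
      (E.linear-∼ (Isometry.linear γ′) (coloured i j))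

    open Clifford U U-isometry anticommute
    open Coloured 1≉0 (λ j → β (e j)) (λ a → γ (e a)) (orthonormal β′) (orthonormal γ′) c U-y

    -- Column 0 serves as the common base to which all eigenvectors are carried; it shares at least
    -- 10 + 10 - 16 colours with every column.
    linked : ∀ j → ∃[ a ] ∃[ b ] c a 0F ≡ c b j
    linked j =
      let a , _ , shared = shared-avoiding (column-injective j) []
            (ℕ.≤-trans (s≤s z≤n) (four-shared (column-injective 0F) (column-injective j)))
      in a , shared

  coloured-not-restriction : ⊥
  coloured-not-restriction = no-10×10-in-16 c (λ i → row-injective i) (λ j → column-injective j)
    intercalate (relation-even 0F linked)

theorem1 : (g : NormedBilinearMap 10 10 16) → IsIntegral g →
    (h m : ℕ) → .{{_ : NonZero h}} → .{{_ : NonZero m}} →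
    (F : NormedBilinearMap h m m) → ¬ IsRestriction g F
theorem1 g integral h m F restriction = coloured-not-restriction F restriction
  (λ i j → proj₁ (integral-colour g integral i j))
  (λ i j → proj₂ (integral-colour g integral i j))
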